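{- Let $H$ be a polyomino graph with a perfect matching, and let $K$ be a maximum resonant set of $H$. Then $H-K$ has a unique perfect matching.
   Context: A polyomino graph is a connected finite subgraph of the infinite plane square grid such that each interior (finite) face is bounded by a unit square and each edge belongs to at least one such square. For a plane bipartite graph $G$ with a perfect matching $M$, a cycle is $M$-alternating if its edges alternate between edges in $M$ and edges not in $M$; a finite face is $M$-resonant if its boundary is an $M$-alternating cycle. A set $\mathcal{H}$ of finite faces of $G$ is a resonant set if the faces in $\mathcal{H}$ are pairwise vertex-disjoint and there is a perfect matching $M$ of $G$ such that every face in $\mathcal{H}$ is $M$-resonant. A maximum resonant set is a resonant set of largest cardinality. For a set $K$ of faces, $G-K$ denotes the graph obtained from $G$ by deleting all vertices lying on the boundaries of faces in $K$ (the empty graph is considered to have exactly one perfect matching, the empty one). -}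

module Defs where

open import Data.Integer using (ℤ; _+_; _-_; 1ℤ; _<_)
open import Data.Product using (Σ; _×_; _,_; proj₁)
open import Data.Sum using (_⊎_)
open import Data.List using (List; []; _∷_; length)
open import Data.List.Membership.Propositional using (_∈_; _∉_)
open import Data.List.Relation.Unary.All using (All)
open import Data.List.Relation.Unary.AllPairs using (AllPairs)
open import Data.Nat using (ℕ) renaming (_≤_ to _≤ℕ_)
open import Relation.Binary.PropositionalEquality using (_≡_)
open import Relation.Binary.Construct.Closure.ReflexiveTransitive using (Star)
open import Relation.Nullary using (¬_)

Point : Set
Point = ℤ × ℤ

data Dir : Set where
  hor ver : Dir

-- A grid edge: its lower/left endpoint and its direction.
-- (p , hor) joins p to p+(1,0);  (p , ver) joins p to p+(0,1).
Edge : Set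
Edge = Point × Dir

src : Edge → Point
src (p , _) = p

tgt : Edge → Point
tgt ((x , y) , hor) = (x + 1ℤ , y)
tgt ((x , y) , ver) = (x , y + 1ℤ)

Incident : Point → Edge → Set
Incident v e = v ≡ src e ⊎ v ≡ tgt e

-- A unit square (cell) of the grid, given by its lower-left corner.
Cell : Set
Cell = Point

bottom top left right : Cell → Edge
bottom (x , y) = ((x , y) , hor)
top    (x , y) = ((x , y + 1ℤ) , hor)
left   (x , y) = ((x , y) , ver)
right  (x , y) = ((x + 1ℤ , y) , ver)

corners : Cell → List Point
corners (x , y) = (x , y) ∷ (x + 1ℤ , y) ∷ (x , y + 1ℤ) ∷ (x + 1ℤ , y + 1ℤ) ∷ []

-- Finite subgraphs of the grid without isolated vertices, given by
-- their (finite) edge list; vertices are the endpoints of edges.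

GridGraph : Set
GridGraph = List Edge

IsVertex : GridGraph → Point → Set
IsVertex E v = Σ Edge λ e → e ∈ E × Incident v e

Adjacent : GridGraph → Point → Point → Set
Adjacent E p q = Σ Edge λ e → e ∈ E × ((p ≡ src e × q ≡ tgt e) ⊎ (p ≡ tgt e × q ≡ src e))

Connected : GridGraph → Set
Connected E = ∀ p q → IsVertex E p → IsVertex E q → Star (Adjacent E) p q

-- The boundary of the cell c lies in the graph, i.e. c is a finite face of
-- the plane graph E bounded by a unit square (its interior contains no
-- vertex or edge of the grid).
IsSquareFace : GridGraph → Cell → Set
IsSquareFace E c = bottom c ∈ E × top c ∈ E × left c ∈ E × right c ∈ E

-- Moving from a cell to a neighbouring cell through a common side that is
-- NOT an edge of E (so both cells' interiors lie in the same face of E).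
data Cross (E : GridGraph) : Cell → Cell → Set where
  down : ∀ {x y} → bottom (x , y) ∉ E → Cross E (x , y) (x , y - 1ℤ)
  up   : ∀ {x y} → top (x , y)    ∉ E → Cross E (x , y) (x , y + 1ℤ)
  west : ∀ {x y} → left (x , y)   ∉ E → Cross E (x , y) (x - 1ℤ , y)
  east : ∀ {x y} → right (x , y)  ∉ E → Cross E (x , y) (x + 1ℤ , y)

-- A cell strictly to the right of every edge of E lies in the outer
-- (unbounded) face of E.
FarRight : GridGraph → Cell → Set
FarRight E d = All (λ e → proj₁ (src e) < proj₁ d) E

InOuterFace : GridGraph → Cell → Set
InOuterFace E c = Σ Cell λ d → Star (Cross E) c d × FarRight E d

IsSideOf : Edge → Cell → Set
IsSideOf e c = e ≡ bottom c ⊎ e ≡ top c ⊎ e ≡ left c ⊎ e ≡ right c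

-- Polyomino graph: connected; every interior face is bounded by a unit
-- square (every cell's interior lies either in a unit-square face or in the
-- outer face); every edge lies on such a square.
IsPolyominoGraph : GridGraph → Set
IsPolyominoGraph E =
  Connected E
  × (∀ c → IsSquareFace E c ⊎ InOuterFace E c)
  × All (λ e → Σ Cell λ c → IsSquareFace E c × IsSideOf e c) E

-- Perfect matchings of a general grid graph given by a vertex predicate V
-- and an edge predicate Ed (edges of Ed have endpoints in V).

IsPerfectMatching : (Point → Set) → (Edge → Set) → List Edge → Set
IsPerfectMatching V Ed M =
  All Ed M
  × (∀ v → V v → Σ Edge λ e → e ∈ M × Incident v e)
  × (∀ v → V v → ∀ e e' → e ∈ M → e' ∈ M → Incident v e → Incident v e' → e ≡ e')

HasUniquePerfectMatching : (Point → Set) → (Edge → Set) → Set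
HasUniquePerfectMatching V Ed =
  Σ (List Edge) λ M → IsPerfectMatching V Ed M
    × (∀ M' → IsPerfectMatching V Ed M' → ∀ e → (e ∈ M' → e ∈ M) × (e ∈ M → e ∈ M'))

IsPM : GridGraph → List Edge → Set
IsPM E M = IsPerfectMatching (IsVertex E) (λ e → e ∈ E) M

IsResonant : List Edge → Cell → Set
IsResonant M c =
  (bottom c ∈ M × top c ∈ M × left c ∉ M × right c ∉ M)
  ⊎ (left c ∈ M × right c ∈ M × bottom c ∉ M × top c ∉ M)

VertexDisjoint : Cell → Cell → Set
VertexDisjoint c c' = ∀ p → p ∈ corners c → p ∉ corners c'

-- A resonant set, given as a list of faces (pairwise vertex-disjoint,
-- hence duplicate-free, so its length is its cardinality).
IsResonantSet : GridGraph → List Cell → Set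
IsResonantSet E K =
  All (IsSquareFace E) K
  × AllPairs VertexDisjoint K
  × Σ (List Edge) (λ M → IsPM E M × All (IsResonant M) K)

IsMaximumResonantSet : GridGraph → List Cell → Set
IsMaximumResonantSet E K =
  IsResonantSet E K × (∀ K' → IsResonantSet E K' → length K' ≤ℕ length K)

Deleted : List Cell → Point → Set
Deleted K v = Σ Cell λ c → c ∈ K × v ∈ corners c

VertexMinus : GridGraph → List Cell → Point → Set
VertexMinus E K v = IsVertex E v × ¬ Deleted K v

EdgeMinus : GridGraph → List Cell → Edge → Set
EdgeMinus E K e = e ∈ E × ¬ Deleted K (src e) × ¬ Deleted K (tgt e)

{-# OPTIONS --safe #-}

-- Suppose that f and g are different perfect matchings of H which agree on the faces in K, K being
-- resonant for both.  Among the vertices where they differ let v₀ be the topmost of those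
-- maximising y - x.  There one matching goes east and the other south, and the square s₁ with
-- north-west vertex v₀ is a face, because H has no holes.  Let u₁ be the vertex of s₁ opposite to v₀
-- and t₁ the square with north-west vertex u₁.
-- If t₁ is not in K, then s₁ or one of its neighbours is disjoint from K and resonant for a suitable
-- perfect matching, so K is not maximum.  When f and g differ at u₁ as well, that matching arises by
-- rerouting g along the alternating path which leaves u₁; when they agree, one may have to descend
-- along a staircase of further maximisers of y - x.
-- If t₁ is in K, then replacing t₁ by s₁ gives another maximum resonant set, and suitable changes of
-- f and g still differ away from it.  This increases the sum of y - x over K, hence it terminates.
module Submission where

open import Defs
open import Algebra.Bundles using (module AbelianGroup)
open import Data.Bool using (Bool; true; false; not; _xor_; T; _∧_)
open import Data.Bool.Properties using (not-¬; not-involutive; xor-same)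
open import Data.Bool.Solver using (module xor-∧-Solver)
open import Data.Empty using (⊥; ⊥-elim)
open import Data.Integer as ℤ using (ℤ; 1ℤ; _+_; _-_; +_; -[1+_])
import Data.Integer.Properties as ℤₚ
open import Algebra.Properties.Group (AbelianGroup.group ℤₚ.+-0-abelianGroup) using (∙-cancelˡ; ∙-cancelʳ)
open import Data.Integer.Tactic.RingSolver using (solve-∀)
open import Data.List using (List; []; _∷_; length; _++_; map; filter)
open import Data.List.Membership.Propositional using (_∈_; _∉_; find; lose)
open import Data.List.Membership.Propositional.Properties using (∈-++⁺ˡ; ∈-++⁺ʳ; ∈-map⁺; ∈-filter⁺; ∈-filter⁻)
open import Data.List.Relation.Binary.Permutation.Propositional using (_↭_; prep; swap; ↭-refl; ↭-sym; ↭-trans)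
open import Data.List.Relation.Binary.Permutation.Propositional.Properties using (All-resp-↭; ∈-resp-↭; ↭-length; map⁺)
open import Data.List.Relation.Unary.All as All using (All; []; _∷_)
open import Data.List.Relation.Unary.AllPairs using (AllPairs; []; _∷_)
open import Data.List.Relation.Unary.Any using (here; there; any?)
open import Data.Nat as ℕ using (ℕ; zero; suc; _≡ᵇ_)
open import Data.Nat.ListAction using (sum)
open import Data.Nat.ListAction.Properties using (sum-↭)
import Data.Nat.Properties as ℕₚ
open import Data.Product using (Σ; ∃; _×_; _,_; proj₁; proj₂)
open import Data.Product.Properties using (≡-dec; ,-injectiveˡ; ,-injectiveʳ)
open import Data.Sum using (_⊎_; inj₁; inj₂; [_,_]′)
open import Function using (_∘_; case_of_)
open import Level using (0ℓ)
open import Relation.Binary using (DecidableEquality; Symmetric)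
open import Relation.Binary.Construct.Closure.ReflexiveTransitive using (ε; _◅_)
open import Relation.Binary.PropositionalEquality
open import Relation.Nullary using (¬_; Dec; yes; no; does; contradiction)
open import Relation.Nullary.Decidable using (dec-true; dec-false; ¬?; _×-dec_; _⊎-dec_; map′)
open import Relation.Unary using (Pred; Decidable)

-- Grid coordinates, neighbours and the chessboard colouring.

_≟ₚ_ : DecidableEquality Point
_≟ₚ_ = ≡-dec ℤ._≟_ ℤ._≟_

-- The recursion adds `1ℤ` on the inside, so that for a numeral `n` the term reduces to the iterated
-- `+ 1ℤ` produced by `tgt` and `corners`, and `off (x + 1ℤ) n` is `off x (suc n)` by definition:
-- shifting the frame by one costs nothing.
off : ℤ → ℕ → ℤ
off x zero = x
off x (suc n) = off (x + 1ℤ) n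

off≡+ : ∀ x n → off x n ≡ x + + n
off≡+ x zero = sym (ℤₚ.+-identityʳ x)
off≡+ x (suc n) = trans (off≡+ (x + 1ℤ) n) (ℤₚ.+-assoc x 1ℤ (+ n))

off-suc : ∀ x n → off x (suc n) ≡ off x n + 1ℤ
off-suc x zero = refl
off-suc x (suc n) = off-suc (x + 1ℤ) n

off-injective : ∀ x {m n} → off x m ≡ off x n → m ≡ n
off-injective x {m} {n} eq = ℤₚ.+-injective
  (∙-cancelˡ x (+ m) (+ n) (trans (sym (off≡+ x m)) (trans eq (off≡+ x n))))

+1-injective : ∀ {x x'} → x + 1ℤ ≡ x' + 1ℤ → x ≡ x'
+1-injective {x} {x'} = ∙-cancelʳ 1ℤ x x'

-1+1 : ∀ x → x - 1ℤ + 1ℤ ≡ x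
-1+1 x = trans (ℤₚ.+-assoc x (ℤ.- 1ℤ) 1ℤ) (ℤₚ.+-identityʳ x)

-- For numerals the hypothesis evaluates to the unit type, so it is passed as `_` and distinctness
-- is settled by computation.
off-distinct : ∀ x y i j k l → T (not ((i ≡ᵇ k) ∧ (j ≡ᵇ l))) →
  (off x i , off y j) ≢ (off x k , off y l)
off-distinct x y i j k l t eq
  rewrite off-injective x {i} {k} (,-injectiveˡ eq) | off-injective y {j} {l} (,-injectiveʳ eq)
  = refute k l t
  where
  ≡ᵇ-refl : ∀ n → (n ≡ᵇ n) ≡ true
  ≡ᵇ-refl zero = refl
  ≡ᵇ-refl (suc n) = ≡ᵇ-refl n
  refute : ∀ k l → ¬ T (not ((k ≡ᵇ k) ∧ (l ≡ᵇ l)))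
  refute k l t rewrite ≡ᵇ-refl k | ≡ᵇ-refl l = t

data Nbr : Point → Point → Set where
  toE : ∀ {x y} → Nbr (x , y) (x + 1ℤ , y)
  toW : ∀ {x y} → Nbr (x + 1ℤ , y) (x , y)
  toN : ∀ {x y} → Nbr (x , y) (x , y + 1ℤ)
  toS : ∀ {x y} → Nbr (x , y + 1ℤ) (x , y)

Neighbours : ℤ → ℤ → Point → Set
Neighbours x y q = (q ≡ (x + 1ℤ + 1ℤ , y + 1ℤ) ⊎ q ≡ (x , y + 1ℤ))
                 ⊎ (q ≡ (x + 1ℤ , y + 1ℤ + 1ℤ) ⊎ q ≡ (x + 1ℤ , y))

neighbours : ∀ {x y p q} → Nbr p q → p ≡ (x + 1ℤ , y + 1ℤ) → Neighbours x y q
neighbours toE refl = inj₁ (inj₁ refl)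
neighbours toN refl = inj₂ (inj₁ refl)
neighbours toW eq = inj₁ (inj₂ (cong₂ _,_ (+1-injective (,-injectiveˡ eq)) (,-injectiveʳ eq)))
neighbours toS eq = inj₂ (inj₂ (cong₂ _,_ (,-injectiveˡ eq) (+1-injective (,-injectiveʳ eq))))

odd : ℕ → Bool
odd zero = false
odd (suc n) = not (odd n)

oddℤ : ℤ → Bool
oddℤ z = odd ℤ.∣ z ∣

oddℤ-+1 : ∀ z → oddℤ (z + 1ℤ) ≡ not (oddℤ z)
oddℤ-+1 (+ n) rewrite ℕₚ.+-comm n 1 = refl
oddℤ-+1 -[1+ zero ] = refl
oddℤ-+1 -[1+ suc n ] = sym (not-involutive _)

colour : Point → Bool
colour (x , y) = oddℤ x xor oddℤ y

colour-nbr : ∀ {p q} → Nbr p q → colour q ≡ not (colour p)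
colour-nbr (toE {x} {y}) rewrite oddℤ-+1 x with oddℤ x | oddℤ y
... | false | _ = refl
... | true | _ = sym (not-involutive _)
colour-nbr (toW {x} {y}) rewrite oddℤ-+1 x with oddℤ x | oddℤ y
... | true | _ = refl
... | false | _ = sym (not-involutive _)
colour-nbr (toN {x} {y}) rewrite oddℤ-+1 y with oddℤ x | oddℤ y
... | false | _ = refl
... | true | _ = refl
colour-nbr (toS {x} {y}) rewrite oddℤ-+1 y with oddℤ x | oddℤ y
... | false | _ = sym (not-involutive _)
... | true | _ = sym (not-involutive _)

colour-≢ : ∀ {p q} → colour q ≡ not (colour p) → p ≢ q
colour-≢ c refl = not-¬ refl c

nbr-≢ : ∀ {p q} → Nbr p q → p ≢ q
nbr-≢ = colour-≢ ∘ colour-nbr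

edge-unique : ∀ e e' → src e ≡ src e' → tgt e ≡ tgt e' → e ≡ e'
edge-unique (_ , hor) (_ , hor) refl _ = refl
edge-unique (_ , ver) (_ , ver) refl _ = refl
edge-unique ((x , y) , hor) (_ , ver) refl eq = ⊥-elim (off-distinct x y 1 0 0 1 _ eq)
edge-unique ((x , y) , ver) (_ , hor) refl eq = ⊥-elim (off-distinct x y 0 1 1 0 _ eq)

edge-antisym : ∀ e e' → src e ≡ tgt e' → tgt e ≢ src e'
edge-antisym (_ , hor) ((x , y) , hor) refl eq = off-distinct x y 2 0 0 0 _ eq
edge-antisym (_ , hor) ((x , y) , ver) refl eq = off-distinct x y 1 1 0 0 _ eq
edge-antisym (_ , ver) ((x , y) , hor) refl eq = off-distinct x y 1 1 0 0 _ eq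
edge-antisym (_ , ver) ((x , y) , ver) refl eq = off-distinct x y 0 2 0 0 _ eq

src-nbr-tgt : ∀ e → Nbr (src e) (tgt e)
src-nbr-tgt (_ , hor) = toE
src-nbr-tgt (_ , ver) = toN

tgt-nbr-src : ∀ e → Nbr (tgt e) (src e)
tgt-nbr-src (_ , hor) = toW
tgt-nbr-src (_ , ver) = toS

-- Exchanging partners between two pairs of an involution.

module Switch (f : Point → Point) (a b : Point) where

  abstract
    -- For an involution `f` and distinct pairs, the pairs of `a` and of `b` are replaced by `a , b`
    -- and `f a , f b`.
    switch : Point → Point
    switch v with v ≟ₚ a
    ... | yes _ = b
    ... | no _ with v ≟ₚ b
    ... | yes _ = a
    ... | no _ with v ≟ₚ f a
    ... | yes _ = f b
    ... | no _ with v ≟ₚ f b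
    ... | yes _ = f a
    ... | no _ = f v

    switch-other : ∀ v → v ≢ a → v ≢ b → v ≢ f a → v ≢ f b → switch v ≡ f v
    switch-other v n₁ n₂ n₃ n₄ with v ≟ₚ a
    ... | yes e = contradiction e n₁
    ... | no _ with v ≟ₚ b
    ... | yes e = contradiction e n₂
    ... | no _ with v ≟ₚ f a
    ... | yes e = contradiction e n₃
    ... | no _ with v ≟ₚ f b
    ... | yes e = contradiction e n₄
    ... | no _ = refl

    switch-cases : ∀ v → (v ≡ a ⊎ v ≡ b) ⊎ (v ≡ f a ⊎ v ≡ f b) ⊎ switch v ≡ f v
    switch-cases v with v ≟ₚ a
    ... | yes e = inj₁ (inj₁ e)
    ... | no _ with v ≟ₚ b
    ... | yes e = inj₁ (inj₂ e)
    ... | no _ with v ≟ₚ f a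
    ... | yes e = inj₂ (inj₁ (inj₁ e))
    ... | no _ with v ≟ₚ f b
    ... | yes e = inj₂ (inj₁ (inj₂ e))
    ... | no _ = inj₂ (inj₂ refl)

    switch-fst : switch a ≡ b
    switch-fst with a ≟ₚ a
    ... | yes _ = refl
    ... | no n = contradiction refl n

  module _ (inv : ∀ v → f (f v) ≡ v) (a≢b : a ≢ b) (a≢fa : a ≢ f a) (b≢fb : b ≢ f b) (b≢fa : b ≢ f a) where

    abstract

      a≢fb : a ≢ f b
      a≢fb e = b≢fa (trans (sym (inv b)) (cong f (sym e)))

      switch-snd : switch b ≡ a
      switch-snd with b ≟ₚ a
      ... | yes e = e
      ... | no _ with b ≟ₚ b
      ... | yes _ = refl
      ... | no n = contradiction refl n

      switch-f-fst : switch (f a) ≡ f b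
      switch-f-fst with f a ≟ₚ a
      ... | yes e = contradiction (sym e) a≢fa
      ... | no _ with f a ≟ₚ b
      ... | yes e = contradiction (sym e) b≢fa
      ... | no _ with f a ≟ₚ f a
      ... | yes _ = refl
      ... | no n = contradiction refl n

      switch-f-snd : switch (f b) ≡ f a
      switch-f-snd with f b ≟ₚ a
      ... | yes e = contradiction (sym e) a≢fb
      ... | no _ with f b ≟ₚ b
      ... | yes e = contradiction (sym e) b≢fb
      ... | no _ with f b ≟ₚ f a
      ... | yes e = e
      ... | no _ with f b ≟ₚ f b
      ... | yes _ = refl
      ... | no n = contradiction refl n

      switch-involutive : ∀ v → switch (switch v) ≡ v
      switch-involutive v with v ≟ₚ a
      ... | yes refl = switch-snd
      ... | no n₁ with v ≟ₚ b
      ... | yes refl = switch-fst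
      ... | no n₂ with v ≟ₚ f a
      ... | yes refl = switch-f-snd
      ... | no n₃ with v ≟ₚ f b
      ... | yes refl = switch-f-fst
      ... | no n₄ = trans
        (switch-other (f v)
          (λ e → n₃ (trans (sym (inv v)) (cong f e)))
          (λ e → n₄ (trans (sym (inv v)) (cong f e)))
          (λ e → n₁ (trans (sym (inv v)) (trans (cong f e) (inv a))))
          (λ e → n₂ (trans (sym (inv v)) (trans (cong f e) (inv b)))))
        (inv v)

incident? : ∀ v e → Dec (Incident v e)
incident? v e = (v ≟ₚ src e) ⊎-dec (v ≟ₚ tgt e)

-- The parity of the number of neighbours of `(x + 1ℤ , y + 1ℤ)` equal to `q`. They are listed in
-- the order of the edges in `star`, which lets `star-matched` end with `refl`.
count-neighbours : ℤ → ℤ → Point → Bool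
count-neighbours x y q =
      (does (q ≟ₚ (off x 0 , off y 1)) xor does (q ≟ₚ (off x 2 , off y 1)))
  xor (does (q ≟ₚ (off x 1 , off y 0)) xor does (q ≟ₚ (off x 1 , off y 2)))

private
  does-distinct : ∀ x y i j k l → T (not ((i ≡ᵇ k) ∧ (j ≡ᵇ l))) →
    does ((off x i , off y j) ≟ₚ (off x k , off y l)) ≡ false
  does-distinct x y i j k l t = dec-false (_ ≟ₚ _) (off-distinct x y i j k l t)

  does-refl : ∀ p → does (p ≟ₚ p) ≡ true
  does-refl p = dec-true (p ≟ₚ p) refl

count-neighbour : ∀ x y {q} → Neighbours x y q → count-neighbours x y q ≡ true
count-neighbour x y (inj₁ (inj₁ refl)) = cong₂ _xor_
  (cong₂ _xor_ (does-distinct x y 2 1 0 1 _) (does-refl (off x 2 , off y 1))) (cong₂ _xor_ (does-distinct x y 2 1 1 0 _) (does-distinct x y 2 1 1 2 _))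
count-neighbour x y (inj₁ (inj₂ refl)) = cong₂ _xor_
  (cong₂ _xor_ (does-refl (off x 0 , off y 1)) (does-distinct x y 0 1 2 1 _)) (cong₂ _xor_ (does-distinct x y 0 1 1 0 _) (does-distinct x y 0 1 1 2 _))
count-neighbour x y (inj₂ (inj₁ refl)) = cong₂ _xor_
  (cong₂ _xor_ (does-distinct x y 1 2 0 1 _) (does-distinct x y 1 2 2 1 _)) (cong₂ _xor_ (does-distinct x y 1 2 1 0 _) (does-refl (off x 1 , off y 2)))
count-neighbour x y (inj₂ (inj₂ refl)) = cong₂ _xor_
  (cong₂ _xor_ (does-distinct x y 1 0 0 1 _) (does-distinct x y 1 0 2 1 _)) (cong₂ _xor_ (does-refl (off x 1 , off y 0)) (does-distinct x y 1 0 1 2 _))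

count-self : ∀ x y → count-neighbours x y (x + 1ℤ , y + 1ℤ) ≡ false
count-self x y = cong₂ _xor_
  (cong₂ _xor_ (does-distinct x y 1 1 0 1 _) (does-distinct x y 1 1 2 1 _)) (cong₂ _xor_ (does-distinct x y 1 1 1 0 _) (does-distinct x y 1 1 1 2 _))

-- Bounds over finite lists.

upper-bound : {A : Set} (k : A → ℤ) (xs : List A) → ∃ λ B → ∀ {x} → x ∈ xs → k x ℤ.≤ B
upper-bound k [] = + 0 , λ ()
upper-bound k (x ∷ xs) with upper-bound k xs
... | B , ub = k x ℤ.⊔ B , λ where
  (here refl) → ℤₚ.i≤i⊔j (k x) B
  (there q) → ℤₚ.≤-trans (ub q) (ℤₚ.i≤j⊔i (k x) B)

lower-bound : {A : Set} (k : A → ℤ) (xs : List A) → ∃ λ B → ∀ {x} → x ∈ xs → B ℤ.≤ k x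
lower-bound k xs with upper-bound (λ x → ℤ.- k x) xs
... | B , ub = ℤ.- B , λ {x} q → subst (ℤ.- B ℤ.≤_) (ℤₚ.neg-involutive (k x)) (ℤₚ.neg-mono-≤ (ub q))

i<i+suc : ∀ i n → i ℤ.< i + + suc n
i<i+suc i n = subst (ℤ._< i + + suc n) (ℤₚ.+-identityʳ i) (ℤₚ.+-monoʳ-< i (ℤ.+<+ (ℕ.s≤s ℕ.z≤n)))

reach : ∀ y B → y ℤ.≤ B → ∃ λ n → off y n ≡ B
reach y B y≤B = ℤ.∣ B - y ∣ , trans (off≡+ y _) (trans (cong (λ z → y + z) (ℤₚ.0≤i⇒+∣i∣≡i (ℤₚ.i≤j⇒0≤j-i y≤B)))
  (trans (ℤₚ.+-comm y (B - y)) (trans (ℤₚ.+-assoc B (ℤ.- y) y) (trans (cong (λ z → B + z) (ℤₚ.+-inverseˡ y)) (ℤₚ.+-identityʳ B)))))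

-- Perfect matchings as involutions of the grid.

module Graph (H : GridGraph) where

  V : Point → Set
  V = IsVertex H

  V? : ∀ v → Dec (V v)
  V? v = map′ (λ a → let e , e∈ , i = find a in e , e∈ , i) (λ (e , e∈ , i) → lose e∈ i) (any? (incident? v) H)

  vertices : List Point
  vertices = map src H ++ map tgt H

  V-∈ : ∀ {v} → V v → v ∈ vertices
  V-∈ (e , e∈ , inj₁ refl) = ∈-++⁺ˡ (∈-map⁺ src e∈)
  V-∈ (e , e∈ , inj₂ refl) = ∈-++⁺ʳ (map src H) (∈-map⁺ tgt e∈)

  adjacent-nbr : ∀ {p q} → Adjacent H p q → Nbr p q
  adjacent-nbr (e , _ , inj₁ (refl , refl)) = src-nbr-tgt e
  adjacent-nbr (e , _ , inj₂ (refl , refl)) = tgt-nbr-src e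

  adjacent-sym : ∀ {p q} → Adjacent H p q → Adjacent H q p
  adjacent-sym (e , e∈ , inj₁ (p , q)) = e , e∈ , inj₂ (q , p)
  adjacent-sym (e , e∈ , inj₂ (p , q)) = e , e∈ , inj₁ (q , p)

  adjacent-V : ∀ {p q} → Adjacent H p q → V p
  adjacent-V (e , e∈ , inj₁ (p , _)) = e , e∈ , inj₁ p
  adjacent-V (e , e∈ , inj₂ (p , _)) = e , e∈ , inj₂ p

  edge-adjacent : ∀ e → e ∈ H → Adjacent H (src e) (tgt e)
  edge-adjacent e e∈ = e , e∈ , inj₁ (refl , refl)

  adjacent-edge : ∀ e → Adjacent H (src e) (tgt e) → e ∈ H
  adjacent-edge e (e' , e'∈ , inj₁ (p , q)) = subst (_∈ H) (sym (edge-unique e e' p q)) e'∈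
  adjacent-edge e (e' , e'∈ , inj₂ (p , q)) = ⊥-elim (edge-antisym e e' p q)

  -- A perfect matching is encoded by the map to the partner. Being the identity off the graph makes
  -- it total, so two matchings can be compared at any point and differ only at vertices.
  record Matching (f : Point → Point) : Set where
    field
      invol : ∀ v → f (f v) ≡ v
      adj : ∀ v → V v → Adjacent H v (f v)
      fixed : ∀ v → ¬ V v → f v ≡ v

    flip-≡ : ∀ {p q} → f p ≡ q → f q ≡ p
    flip-≡ {p} refl = invol p

    no-fix : ∀ {v} → V v → v ≢ f v
    no-fix Vv = nbr-≢ (adjacent-nbr (adj _ Vv))

    V-closed : ∀ {v} → V v → V (f v)
    V-closed Vv = adjacent-V (adjacent-sym (adj _ Vv))

    f-neighbours : ∀ x y → V (x + 1ℤ , y + 1ℤ) → Neighbours x y (f (x + 1ℤ , y + 1ℤ))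
    f-neighbours x y Vv = neighbours (adjacent-nbr (adj _ Vv)) refl

    edge-V : ∀ e → f (src e) ≡ tgt e → V (src e)
    edge-V e eq with V? (src e)
    ... | yes Vv = Vv
    ... | no ¬Vv = contradiction (trans (sym (fixed _ ¬Vv)) eq) (nbr-≢ (src-nbr-tgt e))

    edge-H : ∀ e → f (src e) ≡ tgt e → e ∈ H
    edge-H e eq = adjacent-edge e (subst (Adjacent H (src e)) eq (adj _ (edge-V e eq)))

  open Matching

  matched : (Point → Point) → Edge → Bool
  matched f e = does (f (src e) ≟ₚ tgt e)

  matched-flip : ∀ {f} → Matching f → ∀ e → matched f e ≡ does (f (tgt e) ≟ₚ src e)
  matched-flip {f} m e with f (tgt e) ≟ₚ src e
  ... | yes eq = dec-true (f (src e) ≟ₚ tgt e) (flip-≡ m eq)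
  ... | no n = dec-false (f (src e) ≟ₚ tgt e) (n ∘ flip-≡ m)

  -- The parity of the degree at `(x + 1ℤ , y + 1ℤ)`. The shift of the centre avoids subtraction in
  -- the edges arriving from the west and the south.
  star : (Edge → Bool) → ℤ → ℤ → Bool
  star h x y = (h ((x , y + 1ℤ) , hor) xor h ((x + 1ℤ , y + 1ℤ) , hor))
           xor (h ((x + 1ℤ , y) , ver) xor h ((x + 1ℤ , y + 1ℤ) , ver))

  star-matched : ∀ {f} → Matching f → ∀ x y → star (matched f) x y ≡ count-neighbours x y (f (x + 1ℤ , y + 1ℤ))
  star-matched m x y rewrite matched-flip m ((x , y + 1ℤ) , hor) | matched-flip m ((x + 1ℤ , y) , ver) = refl

  star-vertex : ∀ {f} → Matching f → ∀ x y → V (x + 1ℤ , y + 1ℤ) → star (matched f) x y ≡ true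
  star-vertex m x y Vp = trans (star-matched m x y) (count-neighbour x y (f-neighbours m x y Vp))

  star-nonvertex : ∀ {f} → Matching f → ∀ x y → ¬ V (x + 1ℤ , y + 1ℤ) → star (matched f) x y ≡ false
  star-nonvertex m x y ¬Vp = trans (star-matched m x y)
    (trans (cong (count-neighbours x y) (fixed m _ ¬Vp)) (count-self x y))

  empty-row : ∀ y → ∃ λ n → ∀ x → ¬ V (x , off y (suc n))
  empty-row y with upper-bound proj₂ vertices
  ... | B , ub with reach (y + 1ℤ) ((y + 1ℤ) ℤ.⊔ (B + 1ℤ)) (ℤₚ.i≤i⊔j _ _)
  ... | n , eq = n , λ x Vv → ℤₚ.≤⇒≯ (ub (V-∈ Vv)) (subst (B ℤ.<_) (sym eq)
          (ℤₚ.<-≤-trans (i<i+suc B 0) (ℤₚ.i≤j⊔i (y + 1ℤ) (B + 1ℤ))))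

  -- The symmetric difference of two matchings and the parity of rays.

  module Parity {f g : Point → Point} (mf : Matching f) (mg : Matching g) where

    δ : Edge → Bool
    δ e = matched f e xor matched g e

    -- A vertex has one edge in each matching and any other point none, so the two degree parities
    -- cancel.
    star-δ : ∀ x y → star δ x y ≡ false
    star-δ x y = trans
      (solve 8 (λ a b c d a' b' c' d' →
         ((a :+ a') :+ (b :+ b')) :+ ((c :+ c') :+ (d :+ d'))
         := ((a :+ b) :+ (c :+ d)) :+ ((a' :+ b') :+ (c' :+ d'))) refl
         (matched f e₁) (matched f e₂) (matched f e₃) (matched f e₄)
         (matched g e₁) (matched g e₂) (matched g e₃) (matched g e₄))
      cancel
      where
      open xor-∧-Solver
      e₁ e₂ e₃ e₄ : Edge
      e₁ = (x , y + 1ℤ) , hor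
      e₂ = (x + 1ℤ , y + 1ℤ) , hor
      e₃ = (x + 1ℤ , y) , ver
      e₄ = (x + 1ℤ , y + 1ℤ) , ver
      cancel : star (matched f) x y xor star (matched g) x y ≡ false
      cancel with V? (x + 1ℤ , y + 1ℤ)
      ... | yes Vp = cong₂ _xor_ (star-vertex mf x y Vp) (star-vertex mg x y Vp)
      ... | no ¬Vp = cong₂ _xor_ (star-nonvertex mf x y ¬Vp) (star-nonvertex mg x y ¬Vp)

    δ-false : ∀ e → f (src e) ≢ tgt e → g (src e) ≢ tgt e → δ e ≡ false
    δ-false e n₁ n₂ = cong₂ _xor_ (dec-false (f (src e) ≟ₚ tgt e) n₁) (dec-false (g (src e) ≟ₚ tgt e) n₂)

    δ-∉ : ∀ e → e ∉ H → δ e ≡ false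
    δ-∉ e e∉ = δ-false e (e∉ ∘ edge-H mf e) (e∉ ∘ edge-H mg e)

    δ-∉V : ∀ e → ¬ V (src e) → δ e ≡ false
    δ-∉V e ¬V = δ-false e (¬V ∘ edge-V mf e) (¬V ∘ edge-V mg e)

    ray : ℤ → ℤ → ℕ → Bool
    ray x y zero = false
    ray x y (suc n) = δ ((x , y) , hor) xor ray x (y + 1ℤ) n

    -- Adding `star-δ` over the vertices between two neighbouring columns cancels every vertical
    -- edge except the lowest and the highest.
    ray-beside : ∀ n x y → ray x (y + 1ℤ) n xor ray (x + 1ℤ) (y + 1ℤ) n
      ≡ δ ((x + 1ℤ , y) , ver) xor δ ((x + 1ℤ , off y n) , ver)
    ray-beside zero x y = sym (xor-same (δ ((x + 1ℤ , y) , ver)))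
    ray-beside (suc n) x y = begin
      (l xor ray x y₂ n) xor (r xor ray (x + 1ℤ) y₂ n)
        -- Inserting `s xor u` twice completes the star at `(x + 1ℤ , y + 1ℤ)`.
        ≡⟨ solve 6 (λ l a r b s u → (l :+ a) :+ (r :+ b) := (((l :+ r) :+ (s :+ u)) :+ (s :+ u)) :+ (a :+ b)) refl l (ray x y₂ n) r (ray (x + 1ℤ) y₂ n) s u ⟩
      (star δ x y xor (s xor u)) xor (ray x y₂ n xor ray (x + 1ℤ) y₂ n)
        ≡⟨ cong₂ (λ p q → (p xor (s xor u)) xor q) (star-δ x y) (ray-beside n x (y + 1ℤ)) ⟩
      (s xor u) xor (u xor t)
        ≡⟨ solve 3 (λ s u t → (s :+ u) :+ (u :+ t) := s :+ t) refl s u t ⟩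
      s xor t ∎
      where
      open xor-∧-Solver
      open ≡-Reasoning
      y₂ = y + 1ℤ + 1ℤ
      l = δ ((x , y + 1ℤ) , hor)
      r = δ ((x + 1ℤ , y + 1ℤ) , hor)
      s = δ ((x + 1ℤ , y) , ver)
      u = δ ((x + 1ℤ , y + 1ℤ) , ver)
      t = δ ((x + 1ℤ , off (y + 1ℤ) n) , ver)

    -- All degrees in δ are even, so crossing a non-edge of H preserves the parity of the number of
    -- edges of δ above a cell; since it is even far to the right, odd cells are bounded by squares.
    Odd : Cell → Set
    Odd (x , y) = ∃ λ n → ray x (y + 1ℤ) n ≡ true × ∀ x' → ¬ V (x' , off y n)

    odd-up : ∀ x y → δ (top (x , y)) ≡ false → Odd (x , y) → Odd (x , y + 1ℤ)
    -- Length `zero` cannot occur, because the empty ray has parity `false`.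
    odd-up x y δ≡ (suc n , r , e) rewrite δ≡ = n , r , e

    odd-down : ∀ x y → δ (top (x , y)) ≡ false → Odd (x , y + 1ℤ) → Odd (x , y)
    odd-down x y δ≡ (n , r , e) = suc n , trans (cong (_xor ray x (y + 1ℤ + 1ℤ) n) δ≡) r , e

    -- The highest vertical edge left over by `ray-beside` starts in a row without vertices, so only
    -- the common side of the two cells counts.
    ray-beside-≡ : ∀ x y n → δ (right (x , y)) ≡ false → ¬ V (x + 1ℤ , off y n) →
      ray x (y + 1ℤ) n xor ray (x + 1ℤ) (y + 1ℤ) n ≡ false
    ray-beside-≡ x y n δ≡ e = trans (ray-beside n x y)
      (cong₂ _xor_ δ≡ (δ-∉V ((x + 1ℤ , off y n) , ver) e))

    odd-east : ∀ x y → δ (right (x , y)) ≡ false → Odd (x , y) → Odd (x + 1ℤ , y)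
    odd-east x y δ≡ (n , r , e) with ray-beside-≡ x y n δ≡ (e _)
    ... | q rewrite r with ray (x + 1ℤ) (y + 1ℤ) n in eq
    ... | true = n , eq , e
    ... | false = contradiction q λ ()

    odd-west : ∀ x y → δ (right (x , y)) ≡ false → Odd (x + 1ℤ , y) → Odd (x , y)
    odd-west x y δ≡ (n , r , e) with ray-beside-≡ x y n δ≡ (e _)
    ... | q rewrite r with ray x (y + 1ℤ) n in eq
    ... | true = n , eq , e
    ... | false = contradiction q λ ()

    odd-cross : ∀ {c d} → Cross H c d → Odd c → Odd d
    odd-cross (up {x} {y} e∉) = odd-up x y (δ-∉ _ e∉)
    odd-cross (east {x} {y} e∉) = odd-east x y (δ-∉ _ e∉)
    odd-cross (down {x} {y} e∉) o = odd-down x (y - 1ℤ)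
      (trans (cong (λ z → δ ((x , z) , hor)) (-1+1 y)) (δ-∉ _ e∉)) (subst (λ z → Odd (x , z)) (sym (-1+1 y)) o)
    odd-cross (west {x} {y} e∉) o = odd-west (x - 1ℤ) y
      (trans (cong (λ z → δ ((z , y) , ver)) (-1+1 x)) (δ-∉ _ e∉)) (subst (λ z → Odd (z , y)) (sym (-1+1 x)) o)

    ray-false : ∀ x y n → (∀ k → δ ((x , off y k) , hor) ≡ false) → ray x y n ≡ false
    ray-false x y zero _ = refl
    ray-false x y (suc n) h = cong₂ _xor_ (h 0) (ray-false x (y + 1ℤ) n (h ∘ suc))

    odd-inner : ∀ {c} → Odd c → ¬ InOuterFace H c
    odd-inner (n , r , _) ((x , y) , ε , far) = contradiction
      (trans (sym r) (ray-false x (y + 1ℤ) n λ k → δ-∉ ((x , off (y + 1ℤ) k) , hor) λ e∈ → ℤₚ.<-irrefl refl (All.lookup far e∈))) λ ()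
    odd-inner o (d , s ◅ ss , far) = odd-inner (odd-cross s o) (d , ss , far)

    odd-start : ∀ x y → δ (top (x , y)) ≡ true →
      (∀ k → δ ((x , off (y + 1ℤ + 1ℤ) k) , hor) ≡ false) → Odd (x , y)
    odd-start x y δ≡ h with empty-row y
    ... | n , e = suc n , cong₂ _xor_ δ≡ (ray-false x _ n h) , e

-- From lists of edges to involutions.

other : ∀ {v e} → Incident v e → Point
other {e = e} (inj₁ _) = tgt e
other {e = e} (inj₂ _) = src e

-- The default `v` at an uncovered point is the value that the field `fixed` of `Matching` demands.
partner : List Edge → Point → Point
partner M v with any? (incident? v) M
... | yes a = other (proj₂ (proj₂ (find a)))
... | no _ = v

-- The predicates are left general in order to serve both the whole graph and the graph after
-- deletion.
module FromList {W : Point → Set} {Ed : Edge → Set} {M : List Edge} (pm : IsPerfectMatching W Ed M)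
  (ends : ∀ {e} → Ed e → W (src e) × W (tgt e)) where

  private
    edges = proj₁ pm
    unique = proj₂ (proj₂ pm)

  partner-src : ∀ {e} → e ∈ M → partner M (src e) ≡ tgt e
  partner-src {e} e∈ with any? (incident? (src e)) M
  ... | no n = contradiction (lose e∈ (inj₁ refl)) n
  ... | yes a with find a
  ... | e' , e'∈ , i with unique _ (proj₁ (ends (All.lookup edges e∈))) e e' e∈ e'∈ (inj₁ refl) i | i
  ... | refl | inj₁ _ = refl
  ... | refl | inj₂ p = contradiction p (nbr-≢ (src-nbr-tgt e))

  partner-tgt : ∀ {e} → e ∈ M → partner M (tgt e) ≡ src e
  partner-tgt {e} e∈ with any? (incident? (tgt e)) M
  ... | no n = contradiction (lose e∈ (inj₂ refl)) n
  ... | yes a with find a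
  ... | e' , e'∈ , i with unique _ (proj₂ (ends (All.lookup edges e∈))) e e' e∈ e'∈ (inj₂ refl) i | i
  ... | refl | inj₂ _ = refl
  ... | refl | inj₁ p = contradiction p (nbr-≢ (tgt-nbr-src e))

  covered : ∀ v → (∃ λ e → e ∈ M × Incident v e) ⊎ ((∀ e → e ∈ M → ¬ Incident v e) × partner M v ≡ v)
  covered v with any? (incident? v) M
  ... | yes a = inj₁ (find a)
  ... | no n = inj₂ ((λ e e∈ i → n (lose e∈ i)) , refl)

  partner-involutive : ∀ v → partner M (partner M v) ≡ v
  partner-involutive v with covered v
  ... | inj₁ (e , e∈ , inj₁ refl) = trans (cong (partner M) (partner-src e∈)) (partner-tgt e∈)
  ... | inj₁ (e , e∈ , inj₂ refl) = trans (cong (partner M) (partner-tgt e∈)) (partner-src e∈)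
  ... | inj₂ (_ , eq) = trans (cong (partner M) eq) eq

  partner-edge : ∀ v → W v → ∃ λ e → e ∈ M × ((v ≡ src e × partner M v ≡ tgt e) ⊎ (v ≡ tgt e × partner M v ≡ src e))
  partner-edge v Wv with proj₁ (proj₂ pm) v Wv
  ... | e , e∈ , inj₁ refl = e , e∈ , inj₁ (refl , partner-src e∈)
  ... | e , e∈ , inj₂ refl = e , e∈ , inj₂ (refl , partner-tgt e∈)

  partner-∈ : ∀ e → W (src e) → partner M (src e) ≡ tgt e → e ∈ M
  partner-∈ e We eq with partner-edge (src e) We
  ... | e' , e'∈ , inj₁ (p , q) = subst (_∈ M) (sym (edge-unique e e' p (trans (sym eq) q))) e'∈
  ... | e' , e'∈ , inj₂ (p , q) = ⊥-elim (edge-antisym e e' p (trans (sym eq) q))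

-- Resonant faces, flips and maximality.

Resonates : (Point → Point) → Cell → Set
Resonates f (x , y) =
    (f (x , y) ≡ (x + 1ℤ , y) × f (x , y + 1ℤ) ≡ (x + 1ℤ , y + 1ℤ))
  ⊎ (f (x , y) ≡ (x , y + 1ℤ) × f (x + 1ℤ , y) ≡ (x + 1ℤ , y + 1ℤ))

resonates-cong : ∀ {f g} c → (∀ p → p ∈ corners c → f p ≡ g p) → Resonates f c → Resonates g c
resonates-cong c eq (inj₁ (p , q)) = inj₁ (trans (sym (eq _ (here refl))) p , trans (sym (eq _ (there (there (here refl))))) q)
resonates-cong c eq (inj₂ (p , q)) = inj₂ (trans (sym (eq _ (here refl))) p , trans (sym (eq _ (there (here refl)))) q)

module Resonance (H : GridGraph) where
  open Graph H
  open Matching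

  toList : (Point → Point) → List Edge
  toList f = filter (λ e → f (src e) ≟ₚ tgt e) H

  ∈-toList⁻ : ∀ f {e} → e ∈ toList f → e ∈ H × f (src e) ≡ tgt e
  ∈-toList⁻ f = ∈-filter⁻ (λ e → f (src e) ≟ₚ tgt e)

  ∈-toList⁺ : ∀ f {e} → e ∈ H → f (src e) ≡ tgt e → e ∈ toList f
  ∈-toList⁺ f = ∈-filter⁺ (λ e → f (src e) ≟ₚ tgt e)

  toList-isPM : ∀ {f} → Matching f → IsPM H (toList f)
  toList-isPM {f} m = All.tabulate (proj₁ ∘ ∈-toList⁻ f) , covers , unique
    where
    covers : ∀ v → V v → Σ Edge λ e → e ∈ toList f × Incident v e
    covers v Vv with adj m v Vv
    ... | e , e∈ , inj₁ (refl , q) = e , ∈-toList⁺ f e∈ q , inj₁ refl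
    ... | e , e∈ , inj₂ (refl , q) = e , ∈-toList⁺ f e∈ (flip-≡ m q) , inj₂ refl
    unique : ∀ v → V v → ∀ e e' → e ∈ toList f → e' ∈ toList f → Incident v e → Incident v e' → e ≡ e'
    unique v _ e e' e∈ e'∈ i i' with proj₂ (∈-toList⁻ f e∈) | proj₂ (∈-toList⁻ f e'∈) | i | i'
    ... | p | p' | inj₁ refl | inj₁ q = edge-unique e e' q (trans (sym p) (trans (cong f q) p'))
    ... | p | p' | inj₁ refl | inj₂ q = ⊥-elim (edge-antisym e e' q (trans (sym p) (trans (cong f q) (flip-≡ m p'))))
    ... | p | p' | inj₂ refl | inj₁ q = ⊥-elim (edge-antisym e' e (sym q) (trans (sym p') (trans (cong f (sym q)) (flip-≡ m p))))
    ... | p | p' | inj₂ refl | inj₂ q = edge-unique e e' (trans (sym (flip-≡ m p)) (trans (cong f q) (flip-≡ m p'))) q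

  toList-resonant : ∀ {f} → Matching f → ∀ c → IsSquareFace H c → Resonates f c → IsResonant (toList f) c
  toList-resonant {f} m (x , y) (b , t , l , r) (inj₁ (p , q)) =
    inj₁ (∈-toList⁺ f b p , ∈-toList⁺ f t q
      , (λ e∈ → off-distinct x y 1 0 0 1 _ (trans (sym p) (proj₂ (∈-toList⁻ f e∈))))
      , (λ e∈ → off-distinct x y 0 0 1 1 _ (trans (sym (flip-≡ m p)) (proj₂ (∈-toList⁻ f e∈)))))
  toList-resonant {f} m (x , y) (b , t , l , r) (inj₂ (p , q)) =
    inj₂ (∈-toList⁺ f l p , ∈-toList⁺ f r q
      , (λ e∈ → off-distinct x y 0 1 1 0 _ (trans (sym p) (proj₂ (∈-toList⁻ f e∈))))
      , (λ e∈ → off-distinct x y 0 0 1 1 _ (trans (sym (flip-≡ m p)) (proj₂ (∈-toList⁻ f e∈)))))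

  resonates-closed : ∀ {f} → Matching f → ∀ c p → Resonates f c → p ∈ corners c → f p ∈ corners c
  resonates-closed m c p (inj₁ (s , t)) (here refl) rewrite s = there (here refl)
  resonates-closed m c p (inj₁ (s , t)) (there (here refl)) rewrite flip-≡ m s = here refl
  resonates-closed m c p (inj₁ (s , t)) (there (there (here refl))) rewrite t = there (there (there (here refl)))
  resonates-closed m c p (inj₁ (s , t)) (there (there (there (here refl)))) rewrite flip-≡ m t = there (there (here refl))
  resonates-closed m c p (inj₂ (s , t)) (here refl) rewrite s = there (there (here refl))
  resonates-closed m c p (inj₂ (s , t)) (there (here refl)) rewrite t = there (there (there (here refl)))
  resonates-closed m c p (inj₂ (s , t)) (there (there (here refl))) rewrite flip-≡ m s = here refl
  resonates-closed m c p (inj₂ (s , t)) (there (there (there (here refl)))) rewrite flip-≡ m t = there (here refl)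

  deleted-closed : ∀ {f K} → Matching f → All (Resonates f) K → ∀ {p} → Deleted K p → Deleted K (f p)
  deleted-closed m res (c , c∈ , p∈) = c , c∈ , resonates-closed m c _ (All.lookup res c∈) p∈

  undeleted-closed : ∀ {f K} → Matching f → All (Resonates f) K → ∀ {p} → ¬ Deleted K p → ¬ Deleted K (f p)
  undeleted-closed m res {p} n d = n (subst (Deleted _) (invol m p) (deleted-closed m res d))

  -- The points `a`, `b`, `f b`, `f a` form an alternating cycle of length four, along which `f` is
  -- switched.
  module Flip {f} (m : Matching f) {a b : Point} (ab : Adjacent H a b) (fafb : Adjacent H (f a) (f b)) (b≢fa : b ≢ f a) where
    private
      module S = Switch f a b
      a≢b = nbr-≢ (adjacent-nbr ab)
      Va = adjacent-V ab
      Vb = adjacent-V (adjacent-sym ab)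
      a≢fa = no-fix m Va
      b≢fb = no-fix m Vb

    flipped : Point → Point
    flipped = S.switch

    at-fst : flipped a ≡ b
    at-fst = S.switch-fst

    at-f-fst : flipped (f a) ≡ f b
    at-f-fst = S.switch-f-fst (invol m) a≢b a≢fa b≢fb b≢fa

    elsewhere : ∀ v → v ≢ a → v ≢ b → v ≢ f a → v ≢ f b → flipped v ≡ f v
    elsewhere = S.switch-other

    matching : Matching flipped
    matching .invol = S.switch-involutive (invol m) a≢b a≢fa b≢fb b≢fa
    matching .adj v Vv with S.switch-cases v
    ... | inj₁ (inj₁ refl) rewrite S.switch-fst = ab
    ... | inj₁ (inj₂ refl) rewrite S.switch-snd (invol m) a≢b a≢fa b≢fb b≢fa = adjacent-sym ab
    ... | inj₂ (inj₁ (inj₁ refl)) rewrite at-f-fst = fafb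
    ... | inj₂ (inj₁ (inj₂ refl)) rewrite S.switch-f-snd (invol m) a≢b a≢fa b≢fb b≢fa = adjacent-sym fafb
    ... | inj₂ (inj₂ eq) rewrite eq = adj m v Vv
    matching .fixed v ¬Vv = trans
      (elsewhere v (λ { refl → ¬Vv Va }) (λ { refl → ¬Vv Vb }) (λ { refl → ¬Vv (V-closed m Va) }) (λ { refl → ¬Vv (V-closed m Vb) }))
      (fixed m v ¬Vv)

  module Maximal {K : List Cell} (faces : All (IsSquareFace H) K) (disjoint : AllPairs VertexDisjoint K)
    (maximal : ∀ K' → IsResonantSet H K' → length K' ℕ.≤ length K) where

    no-larger : ∀ {f} → Matching f → All (Resonates f) K → ∀ c → IsSquareFace H c → Resonates f c →
      ¬ (∀ p → p ∈ corners c → ¬ Deleted K p)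
    no-larger {f} m res c face r avoid = ℕₚ.<-irrefl refl (maximal (c ∷ K)
      ( face ∷ faces
      , All.tabulate (λ d∈ p p∈c p∈d → avoid p p∈c (_ , d∈ , p∈d)) ∷ disjoint
      , toList f , toList-isPM m
      , toList-resonant m c face r ∷ All.zipWith (λ (a , b) → toList-resonant m _ a b) (faces , res)))

    -- Being off `K` has to be checked at one end of each of the two matching edges only, since `f`
    -- preserves it.
    no-horizontal : ∀ {f} → Matching f → All (Resonates f) K → ∀ x y → IsSquareFace H (x , y) →
      f (x , y) ≡ (x + 1ℤ , y) → f (x , y + 1ℤ) ≡ (x + 1ℤ , y + 1ℤ) →
      ¬ Deleted K (x , y) → ¬ Deleted K (x , y + 1ℤ) → ⊥
    no-horizontal m res x y face p q n₁ n₂ = no-larger m res (x , y) face (inj₁ (p , q)) λ where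
      _ (here refl) → n₁
      _ (there (here refl)) → subst (λ z → ¬ Deleted K z) p (undeleted-closed m res n₁)
      _ (there (there (here refl))) → n₂
      _ (there (there (there (here refl)))) → subst (λ z → ¬ Deleted K z) q (undeleted-closed m res n₂)

    no-vertical : ∀ {f} → Matching f → All (Resonates f) K → ∀ x y → IsSquareFace H (x , y) →
      f (x , y) ≡ (x , y + 1ℤ) → f (x + 1ℤ , y) ≡ (x + 1ℤ , y + 1ℤ) →
      ¬ Deleted K (x , y) → ¬ Deleted K (x + 1ℤ , y) → ⊥
    no-vertical m res x y face p q n₁ n₂ = no-larger m res (x , y) face (inj₂ (p , q)) λ where
      _ (here refl) → n₁
      _ (there (here refl)) → n₂
      _ (there (there (here refl))) → subst (λ z → ¬ Deleted K z) p (undeleted-closed m res n₁)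
      _ (there (there (there (here refl)))) → subst (λ z → ¬ Deleted K z) q (undeleted-closed m res n₂)

-- Lengths of filtered lists.

module _ {A : Set} {P Q : Pred A 0ℓ} (P? : Decidable P) (Q? : Decidable Q) (P⊆Q : ∀ {x} → P x → Q x) where

  length-filter-mono : ∀ xs → length (filter P? xs) ℕ.≤ length (filter Q? xs)
  length-filter-mono [] = ℕ.z≤n
  length-filter-mono (x ∷ xs) with P? x | Q? x
  ... | yes p | yes q = ℕ.s≤s (length-filter-mono xs)
  ... | yes p | no ¬q = contradiction (P⊆Q p) ¬q
  ... | no ¬p | yes q = ℕₚ.m≤n⇒m≤1+n (length-filter-mono xs)
  ... | no ¬p | no ¬q = length-filter-mono xs

  length-filter-strict : ∀ {x xs} → x ∈ xs → ¬ P x → Q x → length (filter P? xs) ℕ.< length (filter Q? xs)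
  length-filter-strict {x} {y ∷ xs} (here refl) ¬p q with P? y | Q? y
  ... | yes p | _ = contradiction p ¬p
  ... | no _ | yes _ = ℕ.s≤s (length-filter-mono xs)
  ... | no _ | no ¬q = contradiction q ¬q
  length-filter-strict {x} {y ∷ xs} (there x∈) ¬p q with P? y | Q? y
  ... | yes p | yes q' = ℕ.s≤s (length-filter-strict x∈ ¬p q)
  ... | yes p | no ¬q = contradiction (P⊆Q p) ¬q
  ... | no _ | yes _ = ℕₚ.m≤n⇒m≤1+n (length-filter-strict x∈ ¬p q)
  ... | no _ | no _ = length-filter-strict x∈ ¬p q

-- Rerouting a matching along an alternating path.

module Rerouting (H : GridGraph) where
  open Graph H
  open Matching

  module _ {f g : Point → Point} (mf : Matching f) (mg : Matching g) {u v v' s t : Point}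
    (f-v : f v ≡ v') (g-v : g v ≡ s) (g-v' : g v' ≡ t)
    (Vv : V v) (same-colour : colour u ≡ colour v) (u≢v : u ≢ v) (uv' : Adjacent H u v') (differ : f u ≢ g u) where

    -- The path leaves `u` along `g` and then alternates between `f` and `g`. Either it reaches `v'`
    -- and is closed by the edge from `u` to `v'`, or it comes back to `u` without meeting `v'`, and
    -- then its whole cycle has been changed from `g` to `f`.
    Rerouted : (Point → Point) → Set
    Rerouted X = Matching X × (∀ p → f p ≡ g p → X p ≡ f p) × X v ≡ s × (X u ≡ v' ⊎ (X u ≡ f u × X v' ≡ t))

    private
      Vu : V u
      Vu = adjacent-V uv'

      colour-v' : colour v' ≡ not (colour u)
      colour-v' = colour-nbr (adjacent-nbr uv')

      -- X is a perfect matching except that its pair {u , X u} need not be an edge.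
      record Almost (X : Point → Point) : Set where
        field
          X-invol : ∀ p → X (X p) ≡ p
          X-adj : ∀ p → V p → p ≢ u → p ≢ X u → Adjacent H p (X p)
          X-fixed : ∀ p → ¬ V p → X p ≡ p
          X-agree : ∀ p → f p ≡ g p → X p ≡ f p
          X-colour : ∀ p → V p → colour (X p) ≡ not (colour p)
          X-v : X v ≡ s
          X-v' : X u ≡ v' ⊎ X v' ≡ t

      open Almost

      V-X : ∀ {X} → Almost X → ∀ {p} → V p → V (X p)
      V-X {X} A {p} Vp with V? (X p)
      ... | yes w = w
      ... | no n = contradiction (subst V (trans (sym (X-invol A p)) (X-fixed A _ n)) Vp) n

      complete : ∀ {X} → Almost X → Adjacent H u (X u) → Matching X
      complete A a .invol = X-invol A
      complete {X} A a .adj p Vp with p ≟ₚ u | p ≟ₚ X u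
      ... | yes refl | _ = a
      ... | no _ | yes refl = subst (Adjacent H (X u)) (sym (X-invol A u)) (adjacent-sym a)
      ... | no n₁ | no n₂ = X-adj A p Vp n₁ n₂
      complete A a .fixed = X-fixed A

      disagreements : (Point → Point) → ℕ
      disagreements X = length (filter (λ p → ¬? (X p ≟ₚ f p)) vertices)

      -- The walk advances by two edges: from `b` along `f` to `a`, then along `X` to `c`. The pair
      -- `b , a` becomes an edge of the matching, and `u , c` is the new provisional pair.
      module Step {X} (A : Almost X) (Xu≢v' : X u ≢ v') (fXu≢u : f (X u) ≢ u) where
        b a c : Point
        b = X u
        a = f b
        c = X a

        module S = Switch X b a

        X' : Point → Point
        X' = S.switch

        Xb : X b ≡ u
        Xb = X-invol A u

        Vb : V b
        Vb = V-X A Vu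

        Va : V a
        Va = V-closed mf Vb

        colour-b : colour b ≡ not (colour u)
        colour-b = X-colour A u Vu

        colour-a : colour a ≡ colour u
        colour-a = trans (colour-nbr (adjacent-nbr (adj mf b Vb))) (trans (cong not colour-b) (not-involutive _))

        colour-c : colour c ≡ not (colour u)
        colour-c = trans (X-colour A a Va) (cong not colour-a)

        a≢u : a ≢ u
        a≢u = fXu≢u

        c≢b : c ≢ b
        c≢b e = a≢u (trans (sym (X-invol A a)) (trans (cong X e) Xb))

        opposite : ∀ {p q} → colour p ≡ not (colour u) → colour q ≡ colour u → p ≢ q
        opposite cp cq refl = not-¬ refl (trans (sym cq) cp)

        conditions : b ≢ a × b ≢ X b × a ≢ X a × a ≢ X b
        conditions = opposite colour-b colour-a
          , (λ e → opposite colour-b refl (trans e Xb))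
          , (λ e → opposite colour-c colour-a (sym e))
          , (λ e → a≢u (trans e Xb))

        X'-b : X' b ≡ a
        X'-b = S.switch-fst

        X'-a : X' a ≡ b
        X'-a = let p , q , r , s = conditions in S.switch-snd (X-invol A) p q r s

        X'-u : X' u ≡ c
        X'-u = let p , q , r , s = conditions in trans (cong X' (sym Xb)) (S.switch-f-fst (X-invol A) p q r s)

        X'-c : X' c ≡ u
        X'-c = let p , q , r , s = conditions in trans (S.switch-f-snd (X-invol A) p q r s) Xb

        X'-other : ∀ p → p ≢ b → p ≢ a → p ≢ u → p ≢ c → X' p ≡ X p
        X'-other p n₁ n₂ n₃ n₄ = S.switch-other p n₁ n₂ (λ e → n₃ (trans e Xb)) n₄

        -- This and the next three facts say that every switched point is one where `X` disagrees
        -- with `f`, so no agreement with `f` is destroyed.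
        Xb≢fb : X b ≢ f b
        Xb≢fb e = a≢u (trans (sym e) Xb)

        Xa≢fa : X a ≢ f a
        Xa≢fa e = c≢b (trans e (invol mf b))

        Xc≢fc : X c ≢ f c
        Xc≢fc e = c≢b (trans (sym (invol mf c)) (trans (cong f (trans (sym e) (X-invol A a))) (invol mf b)))

        Xu≢fu : X u ≢ f u
        Xu≢fu e = a≢u (trans (cong f e) (invol mf u))

        next : Almost X'
        next .X-invol = let p , q , r , s = conditions in S.switch-involutive (X-invol A) p q r s
        next .X-adj p Vp p≢u p≢X'u with p ≟ₚ b | p ≟ₚ a
        ... | yes refl | _ = subst (Adjacent H b) (sym X'-b) (adj mf b Vb)
        ... | no _ | yes refl = subst (Adjacent H a) (sym X'-a) (adjacent-sym (adj mf b Vb))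
        ... | no n₁ | no n₂ = subst (Adjacent H p)
          (sym (X'-other p n₁ n₂ p≢u (λ e → p≢X'u (trans e (sym X'-u))))) (X-adj A p Vp p≢u n₁)
        next .X-fixed p ¬Vp = trans
          (X'-other p (λ { refl → ¬Vp Vb }) (λ { refl → ¬Vp Va }) (λ { refl → ¬Vp Vu }) (λ { refl → ¬Vp (V-X A Va) }))
          (X-fixed A p ¬Vp)
        next .X-agree p e = trans
          (X'-other p (λ { refl → Xb≢fb X≡f }) (λ { refl → Xa≢fa X≡f }) (λ { refl → differ e }) (λ { refl → Xc≢fc X≡f })) X≡f
          where X≡f = X-agree A p e
        next .X-colour p Vp with p ≟ₚ b | p ≟ₚ a | p ≟ₚ u | p ≟ₚ c
        ... | yes refl | _ | _ | _ = trans (cong colour X'-b) (colour-nbr (adjacent-nbr (adj mf b Vb)))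
        ... | no _ | yes refl | _ | _ = trans (cong colour X'-a) (trans colour-b (cong not (sym colour-a)))
        ... | no _ | no _ | yes refl | _ = trans (cong colour X'-u) colour-c
        ... | no _ | no _ | no _ | yes refl = trans (cong colour X'-c) (trans (sym (not-involutive _)) (cong not (sym colour-c)))
        ... | no n₁ | no n₂ | no n₃ | no n₄ = trans (cong colour (X'-other p n₁ n₂ n₃ n₄)) (X-colour A p Vp)
        -- The colour of `v` excludes `b` and `c`; if `v` were `a`, then `b` would be `v'`, where
        -- the walk has already stopped.
        next .X-v = trans (X'-other v
          (λ e → opposite colour-b (sym same-colour) (sym e))
          (λ e → Xu≢v' (trans (sym (invol mf b)) (trans (cong f (sym e)) f-v)))
          (u≢v ∘ sym)
          (λ e → opposite colour-c (sym same-colour) (sym e))) (X-v A)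
        next .X-v' with v' ≟ₚ c
        ... | yes e = inj₁ (trans X'-u (sym e))
        ... | no n = inj₂ (trans (X'-other v' (Xu≢v' ∘ sym) (opposite colour-v' colour-a) (opposite colour-v' refl) n)
          ([ (λ e → contradiction e Xu≢v') , (λ e → e) ]′ (X-v' A)))

        -- The point `b` newly agrees with `f`, and no agreement is lost.
        decreasing : disagreements X' ℕ.< disagreements X
        decreasing = length-filter-strict (λ p → ¬? (X' p ≟ₚ f p)) (λ p → ¬? (X p ≟ₚ f p)) subset (V-∈ Vb)
          (λ n → n X'-b) Xb≢fb
          where
          subset : ∀ {p} → X' p ≢ f p → X p ≢ f p
          subset {p} n with p ≟ₚ b | p ≟ₚ a | p ≟ₚ u | p ≟ₚ c
          ... | yes refl | _ | _ | _ = Xb≢fb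
          ... | no _ | yes refl | _ | _ = Xa≢fa
          ... | no _ | no _ | yes refl | _ = Xu≢fu
          ... | no _ | no _ | no _ | yes refl = Xc≢fc
          ... | no n₁ | no n₂ | no n₃ | no n₄ = λ e → n (trans (X'-other p n₁ n₂ n₃ n₄) e)

      loop : ∀ n {X} → Almost X → disagreements X ℕ.< n → ∃ Rerouted
      loop (suc n) {X} A lt with X u ≟ₚ v' | f (X u) ≟ₚ u
      ... | yes e | _ = X , complete A (subst (Adjacent H u) (sym e) uv') , X-agree A , X-v A , inj₁ e
      ... | no n₁ | yes e = X , complete A (subst (Adjacent H u) (sym Xu≡fu) (adj mf u Vu)) , X-agree A , X-v A
              , inj₂ (Xu≡fu , [ (λ e → contradiction e n₁) , (λ e → e) ]′ (X-v' A))
        where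
        Xu≡fu : X u ≡ f u
        Xu≡fu = trans (sym (invol mf (X u))) (cong f e)
      ... | no n₁ | no n₂ = loop n next (ℕₚ.<-≤-trans decreasing (ℕ.s≤s⁻¹ lt))
        where open Step A n₁ n₂

      start : Almost g
      start = record
        { X-invol = invol mg
        ; X-adj = λ p Vp _ _ → adj mg p Vp
        ; X-fixed = fixed mg
        ; X-agree = λ _ → sym
        ; X-colour = λ p Vp → colour-nbr (adjacent-nbr (adj mg p Vp))
        ; X-v = g-v
        ; X-v' = inj₂ g-v'
        }

    reroute : ∃ Rerouted
    reroute = loop (suc (disagreements g)) start ℕₚ.≤-refl

-- The diagonal order and the corners of cells.

val : Point → ℤ
val (x , y) = y - x

val-diagonal : ∀ x y → val (x + 1ℤ , y + 1ℤ) ≡ val (x , y)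
val-diagonal = lemma
  where
  lemma : ∀ x y → (y + 1ℤ) - (x + 1ℤ) ≡ y - x
  lemma = solve-∀

val-west : ∀ x y → val (x + 1ℤ , y) ℤ.< val (x , y)
val-west x y = subst (val (x + 1ℤ , y) ℤ.<_) (lemma x y) (i<i+suc _ 0)
  where
  lemma : ∀ x y → (y - (x + 1ℤ)) + 1ℤ ≡ y - x
  lemma = solve-∀

val-north : ∀ x y k → val (x , y) ℤ.< val (x , off (y + 1ℤ) k)
val-north x y k = subst (val (x , y) ℤ.<_) (sym (trans (cong (_- x) (off≡+ y (suc k))) (lemma x y (+ suc k)))) (i<i+suc _ k)
  where
  lemma : ∀ x y k → (y + k) - x ≡ (y - x) + k
  lemma = solve-∀

<-pred : ∀ {i} j n → i + 1ℤ ℤ.< j + + suc n → i ℤ.< j + + n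
<-pred {i} j n lt with i ℤ.<? j + + n
... | yes p = p
... | no ¬p = contradiction lt (ℤₚ.≤⇒≯ (subst (ℤ._≤ i + 1ℤ) (lemma j (+ n)) (ℤₚ.+-monoˡ-≤ 1ℤ (ℤₚ.≮⇒≥ ¬p))))
  where
  lemma : ∀ j n → j + n + 1ℤ ≡ j + (1ℤ + n)
  lemma = solve-∀

∉-corners : ∀ x y i j k l → T (not ((i ≡ᵇ k) ∧ (j ≡ᵇ l))) → T (not ((i ≡ᵇ suc k) ∧ (j ≡ᵇ l))) →
  T (not ((i ≡ᵇ k) ∧ (j ≡ᵇ suc l))) → T (not ((i ≡ᵇ suc k) ∧ (j ≡ᵇ suc l))) →
  (off x i , off y j) ∉ corners (off x k , off y l)
∉-corners x y i j k l t₁ t₂ t₃ t₄ = λ where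
  (here e) → off-distinct x y i j k l t₁ e
  (there (here e)) → off-distinct x y i j (suc k) l t₂ (trans e (cong (_, off y l) (sym (off-suc x k))))
  (there (there (here e))) → off-distinct x y i j k (suc l) t₃ (trans e (cong (off x k ,_) (sym (off-suc y l))))
  (there (there (there (here e)))) →
    off-distinct x y i j (suc k) (suc l) t₄ (trans e (cong₂ _,_ (sym (off-suc x k)) (sym (off-suc y l))))

-- Matching on the equation moves the origin of the frame back by one, so that points west or south
-- of the old origin also take the form `off`.
predecessor : ∀ x → ∃ λ x' → x ≡ x' + 1ℤ
predecessor x = x - 1ℤ , sym (-1+1 x)

disjoint-unique : ∀ {K c d p} → AllPairs VertexDisjoint K → c ∈ K → d ∈ K → p ∈ corners c → p ∈ corners d → c ≡ d
disjoint-unique (_ ∷ _) (here refl) (here refl) _ _ = refl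
disjoint-unique (x ∷ _) (here refl) (there d∈) p q = contradiction q (All.lookup x d∈ _ p)
disjoint-unique (x ∷ _) (there c∈) (here refl) p q = contradiction p (All.lookup x c∈ _ q)
disjoint-unique (_ ∷ xs) (there c∈) (there d∈) p q = disjoint-unique xs c∈ d∈ p q

-- The north-west corner of the difference of two matchings.

module Corner (H : GridGraph) (polyomino : IsPolyominoGraph H) where
  open Graph H
  open Matching
  open Resonance H

  record Pair (K : List Cell) (f g : Point → Point) : Set where
    field
      mf : Matching f
      mg : Matching g
      resf : All (Resonates f) K
      resg : All (Resonates g) K
      agree : ∀ p → Deleted K p → f p ≡ g p

  pair-sym : ∀ {K f g} → Pair K f g → Pair K g f
  pair-sym P = record { mf = mg ; mg = mf ; resf = resg ; resg = resf ; agree = λ p d → sym (agree p d) }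
    where open Pair P

  Highest : (f g : Point → Point) → Point → Set
  Highest f g p = ∀ q → f q ≢ g q → val q ℤ.≤ val p

  -- The two matchings turn at the corner (x + 1 , y + 2), which is extreme in the north-west direction.
  record Turn (f g : Point → Point) (x y : ℤ) : Set where
    field
      highest : Highest f g (off x 1 , off y 2)
      f-east : f (off x 1 , off y 2) ≡ (off x 2 , off y 2)
      g-south : g (off x 1 , off y 2) ≡ (off x 1 , off y 1)

  module Differ {K f g} (P : Pair K f g) where
    open Pair P

    D : Point → Set
    D p = f p ≢ g p

    D-f : ∀ {p} → D p → D (f p)
    D-f d e = d (sym (flip-≡ mg (trans (sym e) (invol mf _))))

    D-g : ∀ {p} → D p → D (g p)
    D-g d e = d (flip-≡ mf (trans e (invol mg _)))

    D-V : ∀ {p} → D p → V p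
    D-V {p} d with V? p
    ... | yes v = v
    ... | no n = contradiction (trans (fixed mf p n) (sym (fixed mg p n))) d

    D-undeleted : ∀ {p} → D p → ¬ Deleted K p
    D-undeleted d del = d (agree _ del)

    beyond : ∀ p q → Highest f g p → val p ℤ.< val q → f q ≡ g q
    beyond p q h lt with f q ≟ₚ g q
    ... | yes e = e
    ... | no n = contradiction lt (ℤₚ.≤⇒≯ (h q n))

    -- The partner of a point of difference is again one, whereas the western and the northern
    -- neighbour have greater `val` and so are not.
    corner : ∀ x y → Highest f g (off x 1 , off y 2) → D (off x 1 , off y 2) →
      f (off x 1 , off y 2) ≡ (off x 2 , off y 2) ⊎ f (off x 1 , off y 2) ≡ (off x 1 , off y 1)
    corner x y h d with f-neighbours mf x (y + 1ℤ) (D-V d)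
    ... | inj₁ (inj₁ e) = inj₁ e
    ... | inj₁ (inj₂ e) = contradiction (beyond (off x 1 , off y 2) (off x 0 , off y 2) h (val-west x (off y 2))) (subst D e (D-f d))
    ... | inj₂ (inj₁ e) = contradiction (beyond (off x 1 , off y 2) (off x 1 , off y 3) h (val-north (off x 1) (off y 2) 0)) (subst D e (D-f d))
    ... | inj₂ (inj₂ e) = inj₂ e

  module AtTurn {K f g} (P : Pair K f g) {x y} (turn : Turn f g x y) where
    open Pair P
    open Turn turn
    open Differ P
    open Parity mf mg

    --       v₀ -- v₁ -- v₂
    --       |  s₁ |  s₂ |
    -- y₀ -- u₀ -- u₁ -- u₂
    --       |  b₁ |  t₁ |
    --       w₀ -- w₁ -- w₂
    v₀ v₁ v₂ u₀ u₁ u₂ w₀ w₁ w₂ y₀ : Point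
    v₀ = off x 1 , off y 2
    v₁ = off x 2 , off y 2
    v₂ = off x 3 , off y 2
    y₀ = off x 0 , off y 1
    u₀ = off x 1 , off y 1
    u₁ = off x 2 , off y 1
    u₂ = off x 3 , off y 1
    w₀ = off x 1 , off y 0
    w₁ = off x 2 , off y 0
    w₂ = off x 3 , off y 0

    s₁ s₂ b₁ t₁ : Cell
    s₁ = off x 1 , off y 1
    s₂ = off x 2 , off y 1
    b₁ = off x 1 , off y 0
    t₁ = off x 2 , off y 0

    f-v₁ : f v₁ ≡ v₀
    f-v₁ = flip-≡ mf f-east

    g-u₀ : g u₀ ≡ v₀
    g-u₀ = flip-≡ mg g-south

    D-v₀ : D v₀
    D-v₀ e = off-distinct x y 2 2 1 1 _ (trans (sym f-east) (trans e g-south))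

    D-v₁ : D v₁
    D-v₁ = subst D f-east (D-f D-v₀)

    D-u₀ : D u₀
    D-u₀ = subst D g-south (D-g D-v₀)

    face : ∀ {c} → Odd c → IsSquareFace H c
    face {c} o with proj₁ (proj₂ polyomino) c
    ... | inj₁ s = s
    ... | inj₂ out = contradiction out (odd-inner o)

    -- The top side of `s₁` belongs to `f` only, and the points above `v₀` have greater `val`, so
    -- the ray meets exactly one edge of `δ`.
    odd-s₁ : Odd s₁
    odd-s₁ = odd-start (off x 1) (off y 1)
      (cong₂ _xor_ (dec-true (f v₀ ≟ₚ v₁) f-east)
        (dec-false (g v₀ ≟ₚ v₁) λ e → off-distinct x y 1 1 2 2 _ (trans (sym g-south) e)))
      λ k → δ-agree (_ , hor) (beyond v₀ (off x 1 , off (off y 3) k) highest (val-north (off x 1) (off y 2) k))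
      where
      δ-agree : ∀ e → f (src e) ≡ g (src e) → δ e ≡ false
      δ-agree e eq rewrite eq = xor-same (matched g e)

    face-s₁ : IsSquareFace H s₁
    face-s₁ = face odd-s₁

    -- Since `g` matches `u₀` to `v₀`, the side common to `s₁` and `b₁` is not in `δ`, and oddness
    -- passes through it.
    face-b₁ : f u₀ ≢ u₁ → IsSquareFace H b₁
    face-b₁ n = face (odd-down (off x 1) (off y 0)
      (δ-false (u₀ , hor) n λ e → off-distinct x y 1 2 2 1 _ (trans (sym g-u₀) e)) odd-s₁)

    face-s₂ : g u₁ ≢ v₁ → IsSquareFace H s₂
    face-s₂ n = face (odd-east (off x 1) (off y 1)
      (δ-false (u₁ , ver) (λ e → off-distinct x y 2 1 1 2 _ (trans (sym (flip-≡ mf e)) f-v₁)) n) odd-s₁)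

    u₁v₁ : Adjacent H u₁ v₁
    u₁v₁ = edge-adjacent (right s₁) (proj₂ (proj₂ (proj₂ face-s₁)))

    V-u₁ : V u₁
    V-u₁ = adjacent-V u₁v₁

    -- Each cell at `u₁` other than `t₁` has one of `v₀`, `v₁`, `u₀` as a corner, and these are
    -- points of difference.
    u₁-undeleted : t₁ ∉ K → ¬ Deleted K u₁
    u₁-undeleted t∉ (c , c∈ , here refl) = D-undeleted D-v₁ (c , c∈ , there (there (here refl)))
    u₁-undeleted t∉ (c , c∈ , there (here e)) = D-undeleted D-v₀
      (c , c∈ , there (there (here (cong₂ (λ a b → a , b + 1ℤ) (+1-injective (,-injectiveˡ e)) (,-injectiveʳ e)))))
    u₁-undeleted t∉ (c , c∈ , there (there (here e))) =
      t∉ (subst (_∈ K) (sym (cong₂ _,_ (,-injectiveˡ e) (+1-injective (,-injectiveʳ e)))) c∈)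
    u₁-undeleted t∉ (c , c∈ , there (there (there (here e)))) = D-undeleted D-u₀
      (c , c∈ , there (there (here (cong₂ _,_ (+1-injective (,-injectiveˡ e)) (,-injectiveʳ e)))))

    module _ (faces : All (IsSquareFace H) K) (disjoint : AllPairs VertexDisjoint K)
      (maximal : ∀ K' → IsResonantSet H K' → length K' ℕ.≤ length K) where
      open Maximal faces disjoint maximal

      -- Otherwise `s₁` would be resonant for `g` and disjoint from `K`.
      g-u₁≢v₁ : g u₁ ≢ v₁
      g-u₁≢v₁ e = no-vertical mg resg _ _ face-s₁ g-u₀ e (D-undeleted D-u₀)
        (subst (λ p → ¬ Deleted K p) (flip-≡ mg e) (undeleted-closed mg resg (D-undeleted D-v₁)))

      g-u₁ : g u₁ ≡ u₂ ⊎ g u₁ ≡ w₁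
      g-u₁ with f-neighbours mg (off x 1) y V-u₁
      ... | inj₁ (inj₁ e) = inj₁ e
      ... | inj₁ (inj₂ e) = contradiction (trans (sym (flip-≡ mg e)) g-u₀) (off-distinct x y 2 1 1 2 _)
      ... | inj₂ (inj₁ e) = contradiction e g-u₁≢v₁
      ... | inj₂ (inj₂ e) = inj₂ e

      f-u₁ : f u₁ ≡ u₂ ⊎ f u₁ ≡ w₁
      f-u₁ with f-neighbours mf (off x 1) y V-u₁
      ... | inj₁ (inj₁ e) = inj₁ e
      ... | inj₁ (inj₂ e) = ⊥-elim (no-horizontal mf resf _ _ face-s₁ (flip-≡ mf e) f-east (D-undeleted D-u₀) (D-undeleted D-v₀))
      ... | inj₂ (inj₁ e) = contradiction (trans (sym (flip-≡ mf e)) f-v₁) (off-distinct x y 2 1 1 2 _)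
      ... | inj₂ (inj₂ e) = inj₂ e

      f-u₀ : f u₀ ≡ y₀ ⊎ f u₀ ≡ w₀
      f-u₀ with f-neighbours mf x y (D-V D-u₀) | f-u₁
      ... | inj₁ (inj₁ e) | inj₁ e' = contradiction (trans (sym (flip-≡ mf e)) e') (off-distinct x y 1 1 3 1 _)
      ... | inj₁ (inj₁ e) | inj₂ e' = contradiction (trans (sym (flip-≡ mf e)) e') (off-distinct x y 1 1 2 0 _)
      ... | inj₁ (inj₂ e) | _ = inj₁ e
      ... | inj₂ (inj₁ e) | _ = contradiction (trans (sym (flip-≡ mf e)) f-east) (off-distinct x y 1 1 2 2 _)
      ... | inj₂ (inj₂ e) | _ = inj₂ e

      -- Otherwise `b₁` would be a face resonant for `f` and disjoint from `K`.
      no-parallel-south : t₁ ∉ K → f u₁ ≡ w₁ → f u₀ ≢ w₀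
      no-parallel-south t∉ p q = no-vertical mf resf _ _
        (face-b₁ λ e → off-distinct x y 1 0 2 1 _ (trans (sym q) e))
        (flip-≡ mf q) (flip-≡ mf p)
        (subst (λ p → ¬ Deleted K p) q (undeleted-closed mf resf (D-undeleted D-u₀)))
        (subst (λ p → ¬ Deleted K p) p (undeleted-closed mf resf (u₁-undeleted t∉)))

  -- The point reached from `u₀` by going west lies on the diagonal of `v₀` and is a point of
  -- difference, hence another maximiser of `val`. There `f` goes east, which leaves only south for
  -- `g`.
  turn-next : ∀ {K f g} → Pair K f g → ∀ {x y} → Turn f g (x + 1ℤ) (y + 1ℤ) →
    f (off x 2 , off y 2) ≡ (off x 1 , off y 2) → Turn f g x y
  turn-next {K} {f} {g} P {x} {y} turn e = record
    { highest = high
    ; f-east = fy₀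
    ; g-south = [ (λ q → contradiction (trans fy₀ (sym q)) Dy₀) , (λ q → q) ]′
        (Differ.corner (pair-sym P) x y (λ q d → high q (d ∘ sym)) (Dy₀ ∘ sym))
    }
    where
    open Pair P
    open AtTurn P turn
    open Differ P
    high : Highest f g (off x 1 , off y 2)
    high q d = subst (val q ℤ.≤_) (val-diagonal (off x 1) (off y 2)) (Turn.highest turn q d)
    fy₀ : f (off x 1 , off y 2) ≡ (off x 2 , off y 2)
    fy₀ = flip-≡ mf e
    Dy₀ : D (off x 1 , off y 2)
    Dy₀ = subst D e (D-f D-u₀)

  module _ {K} (faces : All (IsSquareFace H) K) (disjoint : AllPairs VertexDisjoint K)
    (maximal : ∀ K' → IsResonantSet H K' → length K' ℕ.≤ length K) where

    bottom-row : ℤ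
    bottom-row = proj₁ (lower-bound proj₂ vertices)

    -- Both matchings must go south from `u₁`, so `f` goes west from `u₀` and `turn-next` gives a
    -- maximiser one row lower. The number `n` bounds the height above `bottom-row`, so the descent
    -- ends.
    staircase : ∀ n {f g} → Pair K f g → ∀ x y → Turn f g x y → (off x 2 , off y 0) ∉ K →
      f (off x 2 , off y 1) ≢ (off x 3 , off y 1) → g (off x 2 , off y 1) ≢ (off x 3 , off y 1) →
      off y 2 ℤ.< bottom-row + + n → ⊥
    staircase zero P x y turn t∉ fn gn lt = ℤₚ.≤⇒≯ (proj₂ (lower-bound proj₂ vertices) (V-∈ (D-V D-v₀)))
        (subst (off y 2 ℤ.<_) (ℤₚ.+-identityʳ bottom-row) lt)
      where
      open Differ P
      open AtTurn P turn
    staircase (suc n) {f} {g} P x y turn t∉ fn gn lt with predecessor x | predecessor y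
    ... | x' , refl | y' , refl
      with AtTurn.f-u₁ P turn faces disjoint maximal | AtTurn.g-u₁ P turn faces disjoint maximal | AtTurn.f-u₀ P turn faces disjoint maximal
    ... | inj₁ e | _ | _ = fn e
    ... | inj₂ _ | inj₁ e | _ = gn e
    ... | inj₂ p | inj₂ _ | inj₂ q = AtTurn.no-parallel-south P turn faces disjoint maximal t∉ p q
    -- The old `w₁` is the north-east corner of the new `t₁` and also the new `u₂`. Both matchings
    -- pair it with the old `u₁`, so the new `t₁` is not in `K` and the new `u₁` is not matched to
    -- the new `u₂`.
    ... | inj₂ p | inj₂ q | inj₁ e = staircase n P x' y' (turn-next P turn e)
        (λ c∈ → ∉-corners x' y' 3 2 2 0 _ _ _ _ (subst (_∈ corners (off x' 2 , off y' 0)) (flip-≡ mf p)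
           (resonates-closed mf _ _ (All.lookup resf c∈) (there (there (there (here refl)))))) )
        (λ e → off-distinct x' y' 2 1 3 2 _ (trans (sym (flip-≡ mf e)) (flip-≡ mf p)))
        (λ e → off-distinct x' y' 2 1 3 2 _ (trans (sym (flip-≡ mg e)) (flip-≡ mg q)))
        (<-pred bottom-row n lt)
      where open Pair P

-- Forcing a face into the resonant set and exchanging it.

extract : ∀ {A : Set} {R : A → A → Set} → Symmetric R → ∀ {t xs} → AllPairs R xs → t ∈ xs →
  ∃ λ ys → xs ↭ t ∷ ys × All (R t) ys × AllPairs R ys
extract R-sym (a ∷ as) (here refl) = _ , ↭-refl , a , as
extract R-sym {t} {x ∷ xs} (a ∷ as) (there t∈) with extract R-sym as t∈
... | ys , p , b , bs = x ∷ ys , ↭-trans (prep x p) (swap x t ↭-refl)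
  , R-sym (All.lookup a t∈) ∷ b , All.tail (All-resp-↭ p a) ∷ bs

disjoint-sym : Symmetric VertexDisjoint
disjoint-sym d p p∈ p∈' = d p p∈' p∈

below-+ : ∀ i j → ∃ λ n → i ℤ.< j + + n
below-+ i j = suc ℤ.∣ i - j ∣ , ℤₚ.≤-<-trans i≤ (ℤₚ.+-monoʳ-< j (ℤ.+<+ (ℕₚ.n<1+n _)))
  where
  lemma : ∀ i j → j + (i - j) ≡ i
  lemma = solve-∀
  i≤∣i∣ : ∀ i → i ℤ.≤ + ℤ.∣ i ∣
  i≤∣i∣ (+ n) = ℤₚ.≤-refl
  i≤∣i∣ -[1+ n ] = ℤ.-≤+
  i≤ : i ℤ.≤ j + + ℤ.∣ i - j ∣
  i≤ = subst (ℤ._≤ j + + ℤ.∣ i - j ∣) (lemma i j) (ℤₚ.+-monoʳ-≤ j (i≤∣i∣ (i - j)))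

module Descent (H : GridGraph) (polyomino : IsPolyominoGraph H) where
  open Graph H
  open Matching
  open Resonance H
  open Corner H polyomino
  open Rerouting H

  vertical : ∀ {f} → Matching f → ∀ x y → IsSquareFace H (x , y) → Resonates f (x , y) →
    ∃ λ f' → Matching f' × f' (x , y) ≡ (x , y + 1ℤ) × f' (x + 1ℤ , y) ≡ (x + 1ℤ , y + 1ℤ)
      × (∀ p → p ∉ corners (x , y) → f' p ≡ f p)
  vertical {f} m x y face (inj₂ (p , q)) = f , m , p , q , λ _ _ → refl
  vertical {f} m x y (b , t , l , r) (inj₁ (p , q)) = flipped , matching , at-fst
      , trans (cong flipped (sym p)) (trans at-f-fst q)
      , λ v v∉ → elsewhere v (λ e → v∉ (here e)) (λ e → v∉ (there (there (here e))))
          (λ e → v∉ (there (here (trans e p)))) (λ e → v∉ (there (there (there (here (trans e q))))))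
    where
    open Flip m (edge-adjacent (left (x , y)) l)
      (subst₂ (Adjacent H) (sym p) (sym q) (edge-adjacent (right (x , y)) r))
      (λ e → off-distinct x y 0 1 1 0 _ (trans e p))

  horizontal : ∀ {f} → Matching f → ∀ x y → IsSquareFace H (x , y) → Resonates f (x , y) →
    ∃ λ f' → Matching f' × f' (x , y) ≡ (x + 1ℤ , y) × f' (x , y + 1ℤ) ≡ (x + 1ℤ , y + 1ℤ)
      × (∀ p → p ∉ corners (x , y) → f' p ≡ f p)
  horizontal {f} m x y face (inj₁ (p , q)) = f , m , p , q , λ _ _ → refl
  horizontal {f} m x y (b , t , l , r) (inj₂ (p , q)) = flipped , matching , at-fst
      , trans (cong flipped (sym p)) (trans at-f-fst q)
      , λ v v∉ → elsewhere v (λ e → v∉ (here e)) (λ e → v∉ (there (here e)))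
          (λ e → v∉ (there (there (here (trans e p))))) (λ e → v∉ (there (there (there (here (trans e q))))))
    where
    open Flip m (edge-adjacent (bottom (x , y)) b)
      (subst₂ (Adjacent H) (sym p) (sym q) (edge-adjacent (top (x , y)) t))
      (λ e → off-distinct x y 1 0 0 1 _ (trans e p))

  module _ {K} (faces : All (IsSquareFace H) K) (disjoint : AllPairs VertexDisjoint K)
    (maximal : ∀ K' → IsResonantSet H K' → length K' ℕ.≤ length K) where
    open Maximal faces disjoint maximal

    no-staircase : ∀ {f g} → Pair K f g → ∀ x y → Turn f g x y → (off x 2 , off y 0) ∉ K →
      f (off x 2 , off y 1) ≢ (off x 3 , off y 1) → g (off x 2 , off y 1) ≢ (off x 3 , off y 1) → ⊥
    no-staircase P x y turn t∉ fn gn =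
      let n , lt = below-+ (off y 2) (bottom-row faces disjoint maximal)
      in staircase faces disjoint maximal n P x y turn t∉ fn gn lt

    -- After a step west the new `t₁` would meet the old one in a corner, hence lie outside `K`.
    -- That corner is the new `u₂`; it is matched within the old `t₁`, so neither matching goes east
    -- from the new `u₁`.
    no-step-west : ∀ {f g} → Pair K f g → ∀ x y → Turn f g x y → (off x 2 , off y 0) ∈ K →
      f (off x 1 , off y 1) ≢ (off x 0 , off y 1)
    no-step-west P x y turn t∈ e with predecessor x | predecessor y
    ... | x' , refl | y' , refl = no-staircase P x' y' (turn-next P turn e)
        (λ c∈ → off-distinct x' y' 2 0 3 1 _ (disjoint-unique disjoint c∈ t∈ (there (there (there (here refl)))) (here refl)))
        (unmatched mf resf) (unmatched mg resg)
      where
      open Pair P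
      unmatched : ∀ {h} → Matching h → All (Resonates h) K → h (off x' 2 , off y' 1) ≢ (off x' 3 , off y' 1)
      unmatched m res q = ∉-corners x' y' 2 1 3 1 _ _ _ _
        (subst (_∈ corners (off x' 3 , off y' 1)) (flip-≡ m q) (resonates-closed m _ _ (All.lookup res t∈) (here refl)))

    module TopTurn {f g} (P : Pair K f g) {x y} (turn : Turn f g x y)
      (topmost : f (off x 2 , off y 3) ≡ g (off x 2 , off y 3)) where
      open Pair P
      open Turn turn
      open Differ P
      open AtTurn P turn

      -- Of the other neighbours of `v₁`, the western one is matched to `u₀`, the southern one is
      -- excluded by `g-u₁≢v₁`, and the northern one is by `topmost` no point of difference.
      g-v₁ : g v₁ ≡ v₂
      g-v₁ with f-neighbours mg (off x 1) (off y 1) (D-V D-v₁)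
      ... | inj₁ (inj₁ e) = e
      ... | inj₁ (inj₂ e) = contradiction (trans (sym (flip-≡ mg e)) g-south) (off-distinct x y 2 2 1 1 _)
      ... | inj₂ (inj₁ e) = contradiction topmost (subst D e (D-g D-v₁))
      ... | inj₂ (inj₂ e) = contradiction (flip-≡ mg e) (g-u₁≢v₁ faces disjoint maximal)

      face-s₂' : IsSquareFace H s₂
      face-s₂' = face-s₂ (g-u₁≢v₁ faces disjoint maximal)

      -- If `g` goes east from `u₁`, then `s₂` is resonant for `g`; if both matchings go south, the
      -- staircase applies; the remaining case needs rerouting.
      t₁∈K : ¬ t₁ ∉ K
      t₁∈K t∉ with g-u₁ faces disjoint maximal | f-u₁ faces disjoint maximal
      ... | inj₁ e | _ = no-horizontal mg resg _ _ face-s₂' e g-v₁ (u₁-undeleted t∉) (D-undeleted D-v₁)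
      ... | inj₂ e | inj₂ e' = no-staircase P x y turn t∉
              (λ q → off-distinct x y 2 0 3 1 _ (trans (sym e') q)) (λ q → off-distinct x y 2 0 3 1 _ (trans (sym e) q))
      -- The path starts at `u₁` and is watched for `v₁`. If it arrives there, the new matching
      -- contains `u₁v₁` and `u₀v₀`, and `s₁` is resonant; otherwise it contains `u₁u₂` and `v₁v₂`,
      -- and `s₂` is resonant.
      ... | inj₂ e | inj₁ e' with reroute mf mg f-east g-south g-v₁ (D-V D-v₀) same u₁≢v₀ u₁v₁
                                    (λ q → off-distinct x y 3 1 2 0 _ (trans (sym e') (trans q e)))
        where
        u₁≢v₀ : u₁ ≢ v₀
        u₁≢v₀ = off-distinct x y 2 1 1 2 _
        same : colour u₁ ≡ colour v₀
        same = trans (colour-nbr (toE {off x 1} {off y 1})) (sym (colour-nbr (toN {off x 1} {off y 1})))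
      ... | X , mX , X-agree , X-v₀ , inj₁ X-u₁ =
              no-vertical mX resX _ _ face-s₁ (flip-≡ mX X-v₀) X-u₁ (D-undeleted D-u₀) (u₁-undeleted t∉)
        where
        resX : All (Resonates X) K
        resX = All.tabulate λ {c} c∈ → resonates-cong c
          (λ p p∈ → sym (X-agree p (agree p (c , c∈ , p∈)))) (All.lookup resf c∈)
      ... | X , mX , X-agree , X-v₀ , inj₂ (X-u₁ , X-v₁) =
              no-horizontal mX resX _ _ face-s₂' (trans X-u₁ e') X-v₁ (u₁-undeleted t∉) (D-undeleted D-v₁)
        where
        resX : All (Resonates X) K
        resX = All.tabulate λ {c} c∈ → resonates-cong c
          (λ p p∈ → sym (X-agree p (agree p (c , c∈ , p∈)))) (All.lookup resf c∈)

      -- From `f`, turn `t₁` vertical and flip `b₁`; from `g`, turn `t₁` horizontal and flip `s₂`,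
      -- then `s₁`. Both results contain `u₀u₁` and `v₀v₁`, but one matches `w₁` to `w₀` and the
      -- other to `w₂`.
      module Exchange (t∈ : t₁ ∈ K) where

        private
          f-u₀≡w₀ : f u₀ ≡ w₀
          f-u₀≡w₀ = [ (λ e → contradiction e (no-step-west P x y turn t∈)) , (λ e → e) ]′ (f-u₀ faces disjoint maximal)

          D-w₀ : D w₀
          D-w₀ = subst D f-u₀≡w₀ (D-f D-u₀)

          D-v₂ : D v₂
          D-v₂ = subst D g-v₁ (D-g D-v₁)

          face-b : IsSquareFace H b₁
          face-b = face-b₁ λ e → off-distinct x y 1 0 2 1 _ (trans (sym f-u₀≡w₀) e)

          u₀u₁ : Adjacent H u₀ u₁
          u₀u₁ = edge-adjacent (bottom s₁) (proj₁ face-s₁)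

          v₀v₁ : Adjacent H v₀ v₁
          v₀v₁ = edge-adjacent (top s₁) (proj₁ (proj₂ face-s₁))

          face-t : IsSquareFace H t₁
          face-t = All.lookup faces t∈

          ∉t : ∀ {p} → D p → p ∉ corners t₁
          ∉t d p∈ = D-undeleted d (t₁ , t∈ , p∈)

          fv = vertical mf _ _ face-t (All.lookup resf t∈)
          fᵥ = proj₁ fv
          mfᵥ = proj₁ (proj₂ fv)

          fᵥ-u₁ : fᵥ u₁ ≡ w₁
          fᵥ-u₁ = flip-≡ mfᵥ (proj₁ (proj₂ (proj₂ fv)))

          fᵥ-other : ∀ p → p ∉ corners t₁ → fᵥ p ≡ f p
          fᵥ-other = proj₂ (proj₂ (proj₂ (proj₂ fv)))

          fᵥ-u₀ : fᵥ u₀ ≡ w₀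
          fᵥ-u₀ = trans (fᵥ-other u₀ (∉t D-u₀)) f-u₀≡w₀

          module F = Flip mfᵥ u₀u₁
            (subst₂ (Adjacent H) (sym fᵥ-u₀) (sym fᵥ-u₁) (edge-adjacent (bottom b₁) (proj₁ face-b)))
            (λ e → off-distinct x y 2 1 1 0 _ (trans e fᵥ-u₀))

          gh = horizontal mg _ _ face-t (All.lookup resg t∈)
          gₕ = proj₁ gh
          mgₕ = proj₁ (proj₂ gh)

          gₕ-w₁ : gₕ w₁ ≡ w₂
          gₕ-w₁ = proj₁ (proj₂ (proj₂ gh))

          gₕ-u₁ : gₕ u₁ ≡ u₂
          gₕ-u₁ = proj₁ (proj₂ (proj₂ (proj₂ gh)))

          gₕ-other : ∀ p → p ∉ corners t₁ → gₕ p ≡ g p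
          gₕ-other = proj₂ (proj₂ (proj₂ (proj₂ gh)))

          gₕ-v₁ : gₕ v₁ ≡ v₂
          gₕ-v₁ = trans (gₕ-other v₁ (∉t D-v₁)) g-v₁

          module G₁ = Flip mgₕ (adjacent-sym u₁v₁)
            (subst₂ (Adjacent H) (sym gₕ-v₁) (sym gₕ-u₁)
              (adjacent-sym (edge-adjacent (right s₂) (proj₂ (proj₂ (proj₂ face-s₂'))))))
            (λ e → off-distinct x y 2 1 3 2 _ (trans e gₕ-v₁))

          g₁-v₀ : G₁.flipped v₀ ≡ u₀
          g₁-v₀ = trans (G₁.elsewhere v₀ (off-distinct x y 1 2 2 2 _) (off-distinct x y 1 2 2 1 _)
              (λ e → off-distinct x y 1 2 3 2 _ (trans e gₕ-v₁)) (λ e → off-distinct x y 1 2 3 1 _ (trans e gₕ-u₁)))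
            (trans (gₕ-other v₀ (∉t D-v₀)) g-south)

          module G₂ = Flip G₁.matching v₀v₁
            (subst₂ (Adjacent H) (sym g₁-v₀) (sym G₁.at-fst) u₀u₁)
            (λ e → off-distinct x y 2 2 1 1 _ (trans e g₁-v₀))

        f' g' : Point → Point
        f' = F.flipped
        g' = G₂.flipped

        private
          f'-v₀ : f' v₀ ≡ v₁
          f'-v₀ = trans (F.elsewhere v₀ (off-distinct x y 1 2 1 1 _) (off-distinct x y 1 2 2 1 _)
              (λ e → off-distinct x y 1 2 1 0 _ (trans e fᵥ-u₀)) (λ e → off-distinct x y 1 2 2 0 _ (trans e fᵥ-u₁)))
            (trans (fᵥ-other v₀ (∉t D-v₀)) f-east)

          f'-w₀ : f' w₀ ≡ w₁
          f'-w₀ = trans (cong f' (sym fᵥ-u₀)) (trans F.at-f-fst fᵥ-u₁)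

          g'-u₀ : g' u₀ ≡ u₁
          g'-u₀ = trans (cong g' (sym g₁-v₀)) (trans G₂.at-f-fst G₁.at-fst)

          g'-w₁ : g' w₁ ≡ w₂
          g'-w₁ = trans (G₂.elsewhere w₁ (off-distinct x y 2 0 1 2 _) (off-distinct x y 2 0 2 2 _)
              (λ e → off-distinct x y 2 0 1 1 _ (trans e g₁-v₀)) (λ e → off-distinct x y 2 0 2 1 _ (trans e G₁.at-fst)))
            (trans (G₁.elsewhere w₁ (off-distinct x y 2 0 2 2 _) (off-distinct x y 2 0 2 1 _)
              (λ e → off-distinct x y 2 0 3 2 _ (trans e gₕ-v₁)) (λ e → off-distinct x y 2 0 3 1 _ (trans e gₕ-u₁)))
            gₕ-w₁)

        f'≢g' : f' w₁ ≢ g' w₁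
        f'≢g' e = off-distinct x y 1 0 3 0 _ (trans (sym (flip-≡ F.matching f'-w₀)) (trans e g'-w₁))

        private
          -- Every flipped vertex outside `t₁` is a point of difference of `f` and `g`.
          untouched : ∀ {p} → f p ≡ g p → p ∉ corners t₁ → f' p ≡ f p × g' p ≡ g p
          untouched {p} e p∉ =
              trans (F.elsewhere p (λ { refl → D-u₀ e }) (λ { refl → p∉ (there (there (here refl))) })
                (λ q → avoid D-w₀ (trans q fᵥ-u₀)) (λ q → p∉ (here (trans q fᵥ-u₁)))) (fᵥ-other p p∉)
            , trans (G₂.elsewhere p (avoid D-v₀) (avoid D-v₁)
                (λ q → avoid D-u₀ (trans q g₁-v₀)) (λ q → p∉ (there (there (here (trans q G₁.at-fst))))))
              (trans (G₁.elsewhere p (avoid D-v₁) (λ q → p∉ (there (there (here q))))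
                (λ q → avoid D-v₂ (trans q gₕ-v₁)) (λ q → p∉ (there (there (there (here (trans q gₕ-u₁)))))))
              (gₕ-other p p∉))
            where
            avoid : ∀ {q} → D q → p ≢ q
            avoid d refl = d e

          extracted = extract disjoint-sym disjoint t∈

        K₀ : List Cell
        K₀ = proj₁ extracted

        K↭ : K ↭ t₁ ∷ K₀
        K↭ = proj₁ (proj₂ extracted)

        private
          ∈K : ∀ {c} → c ∈ K₀ → c ∈ K
          ∈K c∈ = ∈-resp-↭ (↭-sym K↭) (there c∈)

          apart : ∀ {c p} → c ∈ K₀ → p ∈ corners c → p ∉ corners t₁
          apart c∈ p∈ p∈t = All.lookup (proj₁ (proj₂ (proj₂ extracted))) c∈ _ p∈t p∈

        faces' : All (IsSquareFace H) (s₁ ∷ K₀)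
        faces' = face-s₁ ∷ All.tabulate (All.lookup faces ∘ ∈K)

        -- The corner `u₁` belongs to the removed face `t₁`; the other corners of `s₁` are points of
        -- difference, hence undeleted.
        disjoint' : AllPairs VertexDisjoint (s₁ ∷ K₀)
        disjoint' = All.tabulate (λ {c} c∈ → λ where
              _ (here refl) q → D-undeleted D-u₀ (c , ∈K c∈ , q)
              _ (there (here refl)) q → apart c∈ q (there (there (here refl)))
              _ (there (there (here refl))) q → D-undeleted D-v₀ (c , ∈K c∈ , q)
              _ (there (there (there (here refl)))) q → D-undeleted D-v₁ (c , ∈K c∈ , q))
          ∷ proj₂ (proj₂ (proj₂ extracted))

        pair' : Pair (s₁ ∷ K₀) f' g'
        pair' = record
          { mf = F.matching
          ; mg = G₂.matching
          ; resf = inj₁ (F.at-fst , f'-v₀) ∷ All.tabulate λ {c} c∈ → resonates-cong c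
              (λ p p∈ → sym (proj₁ (untouched (agree p (c , ∈K c∈ , p∈)) (apart c∈ p∈)))) (All.lookup resf (∈K c∈))
          ; resg = inj₁ (g'-u₀ , G₂.at-fst) ∷ All.tabulate λ {c} c∈ → resonates-cong c
              (λ p p∈ → sym (proj₂ (untouched (agree p (c , ∈K c∈ , p∈)) (apart c∈ p∈)))) (All.lookup resg (∈K c∈))
          ; agree = λ where
              p (c , there c∈ , p∈) → let e = agree p (c , ∈K c∈ , p∈) ; q , r = untouched e (apart c∈ p∈)
                                      in trans q (trans e (sym r))
              _ (_ , here refl , here refl) → trans F.at-fst (sym g'-u₀)
              _ (_ , here refl , there (here refl)) → trans (flip-≡ F.matching F.at-fst) (sym (flip-≡ G₂.matching g'-u₀))
              _ (_ , here refl , there (there (here refl))) → trans f'-v₀ (sym G₂.at-fst)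
              _ (_ , here refl , there (there (there (here refl)))) → trans (flip-≡ F.matching f'-v₀) (sym (flip-≡ G₂.matching G₂.at-fst))
          }

-- The choice of the extreme point and the induction on the weight.

argmax : ∀ {A : Set} (k : A → ℤ) {P : Pred A 0ℓ} → Decidable P → ∀ xs → (∃ λ x → x ∈ xs × P x) →
  ∃ λ m → P m × (∀ {x} → x ∈ xs → P x → k x ℤ.≤ k m)
argmax k P? (x ∷ xs) (z , z∈ , Pz) with any? P? xs
... | no ¬a with z∈
...   | there z∈' = contradiction (lose z∈' Pz) ¬a
...   | here refl = x , Pz , λ where
        (here refl) _ → ℤₚ.≤-refl
        (there q) Pq → contradiction (lose q Pq) ¬a
argmax k P? (x ∷ xs) _ | yes a with argmax k P? xs (find a) | P? x
... | m , Pm , max | no ¬Px = m , Pm , λ where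
        (here refl) Px → contradiction Px ¬Px
        (there q) → max q
... | m , Pm , max | yes Px with ℤₚ.≤-total (k x) (k m)
...   | inj₁ x≤m = m , Pm , λ where
        (here refl) _ → x≤m
        (there q) → max q
...   | inj₂ m≤x = x , Px , λ where
        (here refl) _ → ℤₚ.≤-refl
        (there q) Pq → ℤₚ.≤-trans (max q Pq) m≤x

module Uniqueness (H : GridGraph) (polyomino : IsPolyominoGraph H) where
  open Graph H
  open Matching
  open Resonance H
  open Corner H polyomino
  open Descent H polyomino

  private
    bound = upper-bound (val ∘ src) H
    B = proj₁ bound

  -- The lower-left corner of a face is the source of an edge, so `B - val c` is nonnegative for
  -- faces and the absolute value changes nothing there.
  rank : Cell → ℕ
  rank c = ℤ.∣ B - val c ∣

  rank-< : ∀ {s t} → IsSquareFace H s → val t ℤ.< val s → rank s ℕ.< rank t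
  rank-< {s} {t} (b , _) lt = ℤₚ.drop‿+<+ (subst₂ ℤ._<_ (sym (exact s≤B)) (sym (exact (ℤₚ.≤-trans (ℤₚ.<⇒≤ lt) s≤B)))
      (ℤₚ.+-monoʳ-< B (ℤₚ.neg-mono-< lt)))
    where
    s≤B : val s ℤ.≤ B
    s≤B = proj₂ bound b
    exact : ∀ {i} → i ℤ.≤ B → + ℤ.∣ B - i ∣ ≡ B - i
    exact i≤B = ℤₚ.0≤i⇒+∣i∣≡i (ℤₚ.i≤j⇒0≤j-i i≤B)

  weight : List Cell → ℕ
  weight K = sum (map rank K)

  Topmost : (f g : Point → Point) → Point → Set
  Topmost f g p = ∀ q → f q ≢ g q → val q ≡ val p → proj₂ q ℤ.≤ proj₂ p

  top-corner : ∀ {K f g} → Pair K f g → (∃ λ p → f p ≢ g p) →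
    ∃ λ v → f v ≢ g v × Highest f g v × Topmost f g v
  top-corner {K} {f} {g} P (p , d) with argmax val (λ q → ¬? (f q ≟ₚ g q)) vertices (p , V-∈ (Differ.D-V P d) , d)
  ... | m , dm , max with argmax proj₂ (λ q → ¬? (f q ≟ₚ g q) ×-dec (val q ℤ.≟ val m)) vertices
                            (m , V-∈ (Differ.D-V P dm) , dm , refl)
  ... | v , (dv , e) , max' = v , dv
      , (λ q dq → subst (val q ℤ.≤_) (sym e) (max (V-∈ (Differ.D-V P dq)) dq))
      , (λ q dq e' → max' (V-∈ (Differ.D-V P dq)) (dq , trans e' e))

  -- The exchange preserves the number of faces, hence maximality, and lowers the weight because
  -- `s₁` has greater `val` than `t₁`; `n` exceeds the weight.
  no-difference : ∀ n {K f g} → All (IsSquareFace H) K → AllPairs VertexDisjoint K →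
    (∀ K' → IsResonantSet H K' → length K' ℕ.≤ length K) → Pair K f g → (∃ λ p → f p ≢ g p) → ¬ weight K ℕ.< n
  no-difference (suc n) {K} {f} {g} faces disjoint maximal P dif lt with top-corner P dif
  ... | (X , Y) , dv , high , topm with predecessor X | predecessor Y
  ... | x , refl | Y' , refl with predecessor Y'
  ... | y , refl = orient (Differ.corner P x y high dv)
          (Differ.corner (pair-sym P) x y (λ q d → high q (d ∘ sym)) (dv ∘ sym))
    where
    -- This point is one step up the diagonal from the chosen one, which is topmost on it.
    top-z : f (off x 2 , off y 3) ≡ g (off x 2 , off y 3)
    top-z with f (off x 2 , off y 3) ≟ₚ g (off x 2 , off y 3)
    ... | yes e = e
    ... | no d = contradiction (i<i+suc (off y 2) 0) (ℤₚ.≤⇒≯ (topm _ d (val-diagonal (off x 1) (off y 2))))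

    oriented : ∀ {f g} → Pair K f g → Turn f g x y → f (off x 2 , off y 3) ≡ g (off x 2 , off y 3) → ⊥
    oriented Q turn top with any? ((off x 2 , off y 0) ≟ₚ_) K
    ... | no t∉ = t₁∈K t∉
      where open TopTurn faces disjoint maximal Q turn top
    ... | yes t∈ = no-difference n faces' disjoint'
            (λ K' r → subst (length K' ℕ.≤_) (↭-length K↭) (maximal K' r)) pair' (_ , f'≢g')
            (ℕₚ.<-≤-trans lighter (ℕ.s≤s⁻¹ lt))
      where
      open TopTurn faces disjoint maximal Q turn top
      open Exchange t∈
      lighter : weight ((off x 1 , off y 1) ∷ K₀) ℕ.< weight K
      lighter = subst (weight ((off x 1 , off y 1) ∷ K₀) ℕ.<_) (sym (sum-↭ (map⁺ rank K↭)))
        (ℕₚ.+-monoˡ-< (weight K₀) (rank-< {t = off x 2 , off y 0} (All.head faces')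
          (ℤₚ.<-trans (val-west (off x 1) y) (val-north (off x 1) y 0))))

    orient : f (off x 1 , off y 2) ≡ (off x 2 , off y 2) ⊎ f (off x 1 , off y 2) ≡ (off x 1 , off y 1) →
      g (off x 1 , off y 2) ≡ (off x 2 , off y 2) ⊎ g (off x 1 , off y 2) ≡ (off x 1 , off y 1) → ⊥
    orient (inj₁ p) (inj₁ q) = dv (trans p (sym q))
    orient (inj₂ p) (inj₂ q) = dv (trans p (sym q))
    orient (inj₁ p) (inj₂ q) = oriented P (record { highest = high ; f-east = p ; g-south = q }) top-z
    orient (inj₂ p) (inj₁ q) = oriented (pair-sym P)
      (record { highest = λ r d → high r (d ∘ sym) ; f-east = q ; g-south = p }) (sym top-z)

-- Perfect matchings of the graph left after deleting the resonant faces.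

deleted? : ∀ K v → Dec (Deleted K v)
deleted? K v = map′ find (λ (c , c∈ , v∈) → lose c∈ v∈) (any? (λ c → any? (v ≟ₚ_) (corners c)) K)

theorem2p1 : (H : GridGraph) → IsPolyominoGraph H
    → Σ (List Edge) (IsPM H)
    → (K : List Cell) → IsMaximumResonantSet H K
    → HasUniquePerfectMatching (VertexMinus H K) (EdgeMinus H K)
theorem2p1 H polyomino _ K ((faces , disjoint , M , pm , res) , maximal) =
  M₁ , (All.tabulate M₁-edge , M₁-covers , M₁-unique) , λ M' pm' e → M'⊆M₁ pm' , M₁⊆M' pm'
  where
  open Graph H
  open Matching
  open Resonance H
  open Corner H polyomino
  open Uniqueness H polyomino

  ends : ∀ {e} → e ∈ H → V (src e) × V (tgt e)
  ends {e} e∈ = (e , e∈ , inj₁ refl) , (e , e∈ , inj₂ refl)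

  module F = FromList pm ends

  f : Point → Point
  f = partner M

  mf : Matching f
  mf .invol = F.partner-involutive
  mf .adj v Vv with F.partner-edge v Vv
  ... | e , e∈ , j = e , All.lookup (proj₁ pm) e∈ , j
  mf .fixed v ¬Vv with F.covered v
  ... | inj₁ (e , e∈ , i) = contradiction (e , All.lookup (proj₁ pm) e∈ , i) ¬Vv
  ... | inj₂ (_ , eq) = eq

  resf : All (Resonates f) K
  resf = All.map [ (λ (b , t , _) → inj₁ (F.partner-src b , F.partner-src t))
                 , (λ (l , r , _) → inj₂ (F.partner-src l , F.partner-src r)) ]′ res

  survives? : ∀ e → Dec (¬ Deleted K (src e) × ¬ Deleted K (tgt e))
  survives? e = ¬? (deleted? K (src e)) ×-dec ¬? (deleted? K (tgt e))

  -- No edge of `M` has exactly one deleted end, since the corners of each face in `K` are matched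
  -- among themselves; so `M₁` still covers what remains.
  M₁ : List Edge
  M₁ = filter survives? M

  M₁⊆M : ∀ {e} → e ∈ M₁ → e ∈ M × ¬ Deleted K (src e) × ¬ Deleted K (tgt e)
  M₁⊆M = ∈-filter⁻ survives?

  M₁-edge : ∀ {e} → e ∈ M₁ → EdgeMinus H K e
  M₁-edge e∈ = let e∈M , u = M₁⊆M e∈ in All.lookup (proj₁ pm) e∈M , u

  M₁-covers : ∀ v → VertexMinus H K v → Σ Edge λ e → e ∈ M₁ × Incident v e
  M₁-covers v (Vv , n) with F.partner-edge v Vv
  ... | e , e∈ , inj₁ (refl , q) = e , ∈-filter⁺ survives? e∈
          (n , subst (λ p → ¬ Deleted K p) q (undeleted-closed mf resf n)) , inj₁ refl
  ... | e , e∈ , inj₂ (refl , q) = e , ∈-filter⁺ survives? e∈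
          (subst (λ p → ¬ Deleted K p) q (undeleted-closed mf resf n) , n) , inj₂ refl

  M₁-unique : ∀ v → VertexMinus H K v → ∀ e e' → e ∈ M₁ → e' ∈ M₁ → Incident v e → Incident v e' → e ≡ e'
  M₁-unique v (Vv , _) e e' e∈ e'∈ = proj₂ (proj₂ pm) v Vv e e' (proj₁ (M₁⊆M e∈)) (proj₁ (M₁⊆M e'∈))

  module _ {M' : List Edge} (pm' : IsPerfectMatching (VertexMinus H K) (EdgeMinus H K) M') where

    module G = FromList pm' (λ (e∈ , n₁ , n₂) → (proj₁ (ends e∈) , n₁) , (proj₂ (ends e∈) , n₂))

    h : Point → Point
    h = partner M'

    -- The matching `M'` is completed by `M` on the deleted vertices, which gives a perfect matching
    -- of `H` with the faces of `K` resonant.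
    g : Point → Point
    g v with deleted? K v
    ... | yes _ = f v
    ... | no _ = h v

    g-deleted : ∀ {v} → Deleted K v → g v ≡ f v
    g-deleted {v} d with deleted? K v
    ... | yes _ = refl
    ... | no n = contradiction d n

    g-undeleted : ∀ {v} → ¬ Deleted K v → g v ≡ h v
    g-undeleted {v} n with deleted? K v
    ... | yes d = contradiction d n
    ... | no _ = refl

    h-undeleted : ∀ {v} → ¬ Deleted K v → ¬ Deleted K (h v)
    h-undeleted {v} n with G.covered v
    ... | inj₁ (e , e∈ , inj₁ refl) rewrite G.partner-src e∈ = proj₂ (proj₂ (All.lookup (proj₁ pm') e∈))
    ... | inj₁ (e , e∈ , inj₂ refl) rewrite G.partner-tgt e∈ = proj₁ (proj₂ (All.lookup (proj₁ pm') e∈))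
    ... | inj₂ (_ , eq) rewrite eq = n

    mg : Matching g
    mg .invol v = case deleted? K v of λ where
      (yes d) → trans (cong g (g-deleted d)) (trans (g-deleted (deleted-closed mf resf d)) (invol mf v))
      (no n) → trans (cong g (g-undeleted n)) (trans (g-undeleted (h-undeleted n)) (G.partner-involutive v))
    mg .adj v Vv = case deleted? K v of λ where
      (yes d) → subst (Adjacent H v) (sym (g-deleted d)) (adj mf v Vv)
      (no n) → subst (Adjacent H v) (sym (g-undeleted n))
        (let e , e∈ , j = G.partner-edge v (Vv , n) in e , proj₁ (All.lookup (proj₁ pm') e∈) , j)
    mg .fixed v ¬Vv = case deleted? K v of λ where
      (yes d) → trans (g-deleted d) (fixed mf v ¬Vv)
      (no n) → trans (g-undeleted n) ([ (λ (e , e∈ , i) → contradiction (e , proj₁ (All.lookup (proj₁ pm') e∈) , i) ¬Vv) , proj₂ ]′ (G.covered v))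

    pair : Pair K f g
    pair = record
      { mf = mf
      ; mg = mg
      ; resf = resf
      ; resg = All.tabulate λ {c} c∈ → resonates-cong c (λ p p∈ → sym (g-deleted (c , c∈ , p∈))) (All.lookup resf c∈)
      ; agree = λ p d → sym (g-deleted d)
      }

    f≡g : ∀ p → f p ≡ g p
    f≡g p with f p ≟ₚ g p
    ... | yes e = e
    -- Unification with `≤-refl` sets the bound to `suc (weight K)`.
    ... | no d = contradiction ℕₚ.≤-refl (no-difference _ faces disjoint maximal pair (p , d))

    M'⊆M₁ : ∀ {e} → e ∈ M' → e ∈ M₁
    M'⊆M₁ {e} e∈ = let e∈H , n = All.lookup (proj₁ pm') e∈ in ∈-filter⁺ survives?
      (F.partner-∈ e (proj₁ (ends e∈H)) (trans (f≡g _) (trans (g-undeleted (proj₁ n)) (G.partner-src e∈)))) n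

    M₁⊆M' : ∀ {e} → e ∈ M₁ → e ∈ M'
    M₁⊆M' {e} e∈ = let e∈M , n , _ = M₁⊆M e∈ in
      G.partner-∈ e (proj₁ (ends (All.lookup (proj₁ pm) e∈M)) , n)
        (trans (sym (g-undeleted n)) (trans (sym (f≡g _)) (F.partner-src e∈M)))
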